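{- For any $\mathbf{a}, \mathbf{b} \in \mathcal{Q}$, $\mathbf{a} \equiv \mathbf{b}$ implies that $\xi \mathbf{a} \equiv \xi \mathbf{b}$, and if $\mathbf{a}, \mathbf{b} \in \mathcal{R}$, $\mathbf{a} \equiv \mathbf{b}$ implies $\nabla \mathbf{a} \equiv \nabla \mathbf{b}$.
   Context: Colored words are finite words over the alphabet $\overline{\mathbb{Z}}=\{i^{[j]} : i\in\mathbb{Z}, j\in\mathbb{Z}_+\}$ (value $i$, color $j$), totally ordered by value then color; $\mathbb{Z}$ is identified with color-$1$ letters. For a colored word $\boldsymbol{p}$, $\operatorname{maxcol}(\boldsymbol{p})$ is its largest color and $\boldsymbol{p}\uparrow a$ adds $a$ to every color. The colored shuffle product is $\boldsymbol{p}\boldsymbol{q} := \boldsymbol{p} \sqcup\!\sqcup (\boldsymbol{q}\uparrow \operatorname{maxcol}(\boldsymbol{p}))$, where $\sqcup\!\sqcup$ is the (Eilenberg–Mac Lane) shuffle product: the formal sum of all interlacings of the two words preserving the order of each. $\mathcal{Q}=\mathbb{Q}[\overline{\mathbb{Z}}^*]$ is the algebra of colored words under this product. For $\boldsymbol{t}=(t_1,\dots,t_k)$, its maximal bottom row $m(\boldsymbol{t})\in\mathbb{Z}^k$ is defined by $m(\boldsymbol{t})_k=\mathrm{val}(t_k)$ and, for $j<k$, $m(\boldsymbol{t})_j=m(\boldsymbol{t})_{j+1}$ if $t_j\ge t_{j+1}$, and $m(\boldsymbol{t})_j=\min(\mathrm{val}(t_j), m(\boldsymbol{t})_{j+1}-1)$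 if $t_j<t_{j+1}$. Colored words satisfy $\boldsymbol{p}\equiv\boldsymbol{q}$ iff $m(\boldsymbol{p})=m(\boldsymbol{q})$, extended linearly (equivalently, $\mathbf{a}\equiv\mathbf{b}$ iff they have the same image under $\phi:\mathbf{a}\mapsto\overleftarrow{\mathfrak{F}}_{\mathbf{a}}$, the back-stable slide polynomial map). For $w\in S_\mathbb{Z}$, $\mathbf{Sch}(w)=\sum_{\boldsymbol{w}\in\mathcal{RW}(w)}\boldsymbol{w}$ (sum of reduced words), and $\mathcal{R}$ is the subalgebra of $\mathcal{Q}$ generated by all $\mathbf{Sch}(w)$. The linear operators $\nabla,\xi$ on $\mathcal{Q}$ are $\nabla(p_1,\dots,p_k)=\mathrm{val}(p_1)(p_2,\dots,p_k)$ and $\xi(p_1,\dots,p_k)=(p_2,\dots,p_k)$. -}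

module Defs where

open import Data.Bool using (Bool; true; false; if_then_else_; _∧_; _∨_)
open import Data.Nat as ℕ using (ℕ; zero; suc; _⊔_)
import Data.Nat.Properties as ℕP
open import Data.Integer as ℤ using (ℤ; +_; ∣_∣)
import Data.Integer.Properties as ℤP
open import Data.Rational as ℚ using (ℚ; 0ℚ; 1ℚ)
open import Data.List using (List; []; _∷_; _++_; map; concatMap; length; foldr)
import Data.List.Properties as LP
open import Data.List.Relation.Unary.All using (All)
open import Data.Product using (_×_; _,_; proj₁; proj₂; Σ; ∃)
import Data.Product.Properties as PP
open import Relation.Binary.PropositionalEquality using (_≡_)
open import Relation.Binary.Definitions using (DecidableEquality)
open import Relation.Nullary using (¬_; does)

-- Colored letters i^[j]: a pair (i , k) with value i : ℤ and colour
-- j = suc k  (so colours range over the positive integers ℤ₊).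
-- Uncoloured integers are the letters (i , 0), i.e. colour 1.

Letter : Set
Letter = ℤ × ℕ

val : Letter → ℤ
val = proj₁

colour : Letter → ℕ
colour l = suc (proj₂ l)

_≟L_ : DecidableEquality Letter
_≟L_ = PP.≡-dec ℤP._≟_ ℕP._≟_

_<L_ : Letter → Letter → Bool
x <L y = does (val x ℤP.<? val y)
         ∨ (does (val x ℤP.≟ val y) ∧ does (proj₂ x ℕP.<? proj₂ y))

Word : Set
Word = List Letter

_≟W_ : DecidableEquality Word
_≟W_ = LP.≡-dec _≟L_

maxcol : Word → ℕ
maxcol = foldr (λ l m → colour l ⊔ m) 0

_↑_ : Word → ℕ → Word
p ↑ a = map (λ l → (val l , proj₂ l ℕ.+ a)) p

shuffle : Word → Word → List Word
shuffle [] q = q ∷ []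
shuffle (x ∷ p) [] = (x ∷ p) ∷ []
shuffle (x ∷ p) (y ∷ q) =
  map (x ∷_) (shuffle p (y ∷ q)) ++ map (y ∷_) (shuffle (x ∷ p) q)

-- The algebra 𝒬 : finite formal ℚ-linear combinations of colored words,
-- represented as lists of (coefficient , word) terms (to be read as sums).

𝒬 : Set
𝒬 = List (ℚ × Word)

coeff : 𝒬 → Word → ℚ
coeff [] u = 0ℚ
coeff ((c , w) ∷ a) u =
  (if does (w ≟W u) then c else 0ℚ) ℚ.+ coeff a u

_≈𝒬_ : 𝒬 → 𝒬 → Set
a ≈𝒬 b = ∀ u → coeff a u ≡ coeff b u

scale : ℚ → 𝒬 → 𝒬
scale c = map (λ t → (c ℚ.* proj₁ t , proj₂ t))

wordMul : Word → Word → 𝒬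
wordMul p q = map (1ℚ ,_) (shuffle p (q ↑ maxcol p))

_⊛_ : 𝒬 → 𝒬 → 𝒬
a ⊛ b = concatMap (λ s → concatMap (λ t →
          scale (proj₁ s ℚ.* proj₁ t) (wordMul (proj₂ s) (proj₂ t))) b) a

private
  step : Letter → Letter → List ℤ → List ℤ
  step t t' [] = []
  step t t' (m ∷ ms) =
    (if t <L t' then (val t ℤ.⊓ (m ℤ.- ℤ.1ℤ)) else m) ∷ m ∷ ms

mrow : Word → List ℤ
mrow [] = []
mrow (t ∷ []) = val t ∷ []
mrow (t ∷ t' ∷ ts) = step t t' (mrow (t' ∷ ts))

mcoeff : 𝒬 → List ℤ → ℚ
mcoeff [] v = 0ℚ
mcoeff ((c , w) ∷ a) v =
  (if does (LP.≡-dec ℤP._≟_ (mrow w) v) then c else 0ℚ) ℚ.+ mcoeff a v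

-- a ≡ b : the linear extension of  p ≡ q  ⇔  m(p) = m(q)
_≡m_ : 𝒬 → 𝒬 → Set
a ≡m b = ∀ (v : List ℤ) → mcoeff a v ≡ mcoeff b v

∇ : 𝒬 → 𝒬
∇ [] = []
∇ ((c , []) ∷ a) = ∇ a
∇ ((c , p ∷ ps) ∷ a) = (c ℚ.* (val p ℚ./ 1) , ps) ∷ ∇ a

ξ : 𝒬 → 𝒬
ξ [] = []
ξ ((c , []) ∷ a) = ξ a
ξ ((c , p ∷ ps) ∷ a) = (c , ps) ∷ ξ a

record PermZ : Set where
  field
    fun     : ℤ → ℤ
    inv     : ℤ → ℤ
    fun-inv : ∀ x → fun (inv x) ≡ x
    inv-fun : ∀ x → inv (fun x) ≡ x
    bound   : ℕ
    support : ∀ x → bound ℕ.< ∣ x ∣ → fun x ≡ x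

sᵢ : ℤ → ℤ → ℤ
sᵢ i x = if does (x ℤP.≟ i) then i ℤ.+ ℤ.1ℤ
         else (if does (x ℤP.≟ (i ℤ.+ ℤ.1ℤ)) then i else x)

act : List ℤ → ℤ → ℤ
act [] x = x
act (i ∷ is) x = sᵢ i (act is x)

IsReduced : PermZ → Word → Set
IsReduced w u =
  All (λ l → proj₂ l ≡ 0) u
  × (∀ x → act (map val u) x ≡ PermZ.fun w x)
  × (∀ (v : List ℤ) → (∀ x → act v x ≡ PermZ.fun w x) → length u ℕ.≤ length v)

-- s equals Sch(w) = Σ_{u ∈ RW(w)} u  (as a formal linear combination)
IsSch : PermZ → 𝒬 → Set
IsSch w s = ∀ (u : Word) →
  (IsReduced w u → coeff s u ≡ 1ℚ) × (¬ IsReduced w u → coeff s u ≡ 0ℚ)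

data Inℛ : 𝒬 → Set where
  gen   : ∀ {s} (w : PermZ) → IsSch w s → Inℛ s
  unit  : Inℛ ((1ℚ , []) ∷ [])
  add   : ∀ {a b} → Inℛ a → Inℛ b → Inℛ (a ++ b)
  smul  : ∀ {a} (c : ℚ) → Inℛ a → Inℛ (scale c a)
  mul   : ∀ {a b} → Inℛ a → Inℛ b → Inℛ (a ⊛ b)
  resp  : ∀ {a b} → a ≈𝒬 b → Inℛ a → Inℛ b

{-# OPTIONS --safe #-}

-- Let F(p) be the slide polynomial of p in finitely many variables x_L, …, x_{L+n-1}.
-- Then F is multiplicative for the colored shuffle product, depends on p only through
-- m(p), and slide polynomials with distinct m(p) are linearly independent.  The first
-- claim holds since m(ξ p) is m(p) without its first entry.  For the second, compare two
-- characters of 𝒬 with values in polynomials over the dual numbers ℚ[ε]: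
--   p ↦ F(p)(x_L + ε, …, x_{L+n-1} + ε)   and   p ↦ F(p) + ε (val p₁ - L + 1) F(p₂ … p_k).
-- On Sch(w) they agree, by a telescoping identity for the Fomin–Stanley factorization
-- of Schubert polynomials in the nilCoxeter algebra; being multiplicative, they agree on ℛ.
-- If d ∈ ℛ and d ≡ 0, then the first character vanishes on d, and F vanishes on d and on ξ d,
-- so F(∇ d) = 0 and hence ∇ d ≡ 0.
module Submission where

-- The first letter of a word is not determined by its maximal bottom row, so `∇` cannot respect
-- `≡m` on all of 𝒬: the words (7, 5) and (8, 5) both have row (5, 5), but `∇` multiplies the word
-- (5) by 7 and by 8 respectively. On ℛ the weight becomes visible to slide polynomials because `∇`
-- acts there as a sum of partial derivatives. The sum over all variables x_j with j going to -∞
-- would be infinite, so the variables are cut off below L. The derivative then weights a first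
-- letter v by v - L + 1: it computes ∇ + (1 - L) ξ, and the part that depends on the cut-off
-- disappears because ξ respects `≡m`. Dual numbers turn the Leibniz rule into multiplicativity, so
-- that generators of ℛ are enough. The nilCoxeter relations hold for the coefficients of Sch(w) as
-- a whole, and in general not for single words; the telescoping is therefore carried out on
-- functions of words that obey the relations, and matched with sums over words only afterwards.

open import Defs
open import Data.Product using (_×_)
open import Algebra.Bundles using (CommutativeSemiring)
open import Algebra.Structures using (IsCommutativeSemiring; module IsCommutativeRing)
open import Algebra.Structures.Biased using (isCommutativeSemiringˡ; isCommutativeMonoidˡ)
open import Data.Bool using (Bool; true; false; if_then_else_; _∧_; not)
open import Data.Empty using (⊥-elim)
open import Data.Integer as ℤ using (ℤ; ∣_∣)
import Data.Integer.Properties as ℤP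
open import Data.List using (List; []; _∷_; _++_; map; concatMap; length; replicate)
import Data.List.Properties as LP
open import Data.List.Relation.Unary.All as All using (All; []; _∷_)
import Data.List.Relation.Unary.All.Properties as AllP
open import Data.List.Relation.Unary.Linked as Linked using (Linked; []; [-]; _∷_)
open import Data.Maybe as Maybe using (Maybe; just; nothing; maybe′)
open import Data.Nat as ℕ using (ℕ; zero; suc; s≤s; z≤n)
import Data.Nat.Properties as ℕP
open import Data.Product using (_,_; proj₁; proj₂; ∃)
open import Data.Rational as ℚ using (ℚ; 0ℚ; 1ℚ)
import Data.Rational.Properties as ℚP
open import Data.Rational.Solver using (module +-*-Solver)
import Data.Rational.Unnormalised as ℚᵘ
import Data.Rational.Unnormalised.Properties as ℚᵘP
open import Data.Sum using (_⊎_; inj₁; inj₂)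
open import Data.Unit using (⊤; tt)
open import Data.Vec as Vec using (Vec; []; _∷_)
open import Function using (_∘_)
open import Relation.Binary.Definitions using (DecidableEquality; tri<; tri≈; tri>)
open import Relation.Binary.PropositionalEquality
open import Relation.Nullary using (¬_; Dec; does; yes; no)
open import Relation.Nullary.Decidable using (dec-true; dec-false; decidable-stable; _⊎-dec_; _×-dec_)

-- Formal linear combinations

LC : Set → Set
LC B = List (ℚ × B)

Keys : {B : Set} → (B → Set) → LC B → Set
Keys P = All (P ∘ proj₂)

mapKey : {B C : Set} → (B → C) → LC B → LC C
mapKey k = map (λ t → proj₁ t , k (proj₂ t))

scaleLC : {B : Set} → ℚ → LC B → LC B
scaleLC c = map (λ t → (c ℚ.* proj₁ t , proj₂ t))

module Coefficients {B : Set} (_≟_ : DecidableEquality B) where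

  kcoeff : LC B → B → ℚ
  kcoeff [] k = 0ℚ
  kcoeff ((c , b) ∷ a) k = (if does (b ≟ k) then c else 0ℚ) ℚ.+ kcoeff a k

  remove : B → LC B → LC B
  remove k [] = []
  remove k ((c , b) ∷ a) = if does (b ≟ k) then remove k a else (c , b) ∷ remove k a

  remove-head : ∀ c b a → remove b ((c , b) ∷ a) ≡ remove b a
  remove-head c b a rewrite dec-true (b ≟ b) refl = refl

  length-remove : ∀ k a → length (remove k a) ℕ.≤ length a
  length-remove k [] = z≤n
  length-remove k ((c , b) ∷ a) with does (b ≟ k)
  ... | true  = ℕP.m≤n⇒m≤1+n (length-remove k a)
  ... | false = s≤s (length-remove k a)

  keys-remove : ∀ {P : B → Set} k {a} → Keys P a → Keys P (remove k a)
  keys-remove k {[]} [] = []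
  keys-remove k {(c , b) ∷ a} (p ∷ ps) with does (b ≟ k)
  ... | true  = keys-remove k ps
  ... | false = p ∷ keys-remove k ps

  kcoeff-absent : ∀ {k} a → Keys (_≢ k) a → kcoeff a k ≡ 0ℚ
  kcoeff-absent [] [] = refl
  kcoeff-absent {k} ((c , b) ∷ a) (n ∷ ns)
    rewrite dec-false (b ≟ k) n | kcoeff-absent a ns = refl

  kcoeff-remove-self : ∀ k a → kcoeff (remove k a) k ≡ 0ℚ
  kcoeff-remove-self k [] = refl
  kcoeff-remove-self k ((c , b) ∷ a) with b ≟ k
  ... | yes _ = kcoeff-remove-self k a
  ... | no b≢k rewrite dec-false (b ≟ k) b≢k | kcoeff-remove-self k a = refl

  kcoeff-remove-other : ∀ k {j} a → j ≢ k → kcoeff (remove k a) j ≡ kcoeff a j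
  kcoeff-remove-other k [] j≢k = refl
  kcoeff-remove-other k {j} ((c , b) ∷ a) j≢k with b ≟ k
  ... | yes refl rewrite dec-false (b ≟ j) (j≢k ∘ sym) =
        trans (kcoeff-remove-other k a j≢k) (sym (ℚP.+-identityˡ _))
  ... | no _ = cong ((if does (b ≟ j) then c else 0ℚ) ℚ.+_) (kcoeff-remove-other k a j≢k)

  kcoeff-++ : ∀ a b k → kcoeff (a ++ b) k ≡ kcoeff a k ℚ.+ kcoeff b k
  kcoeff-++ [] b k = sym (ℚP.+-identityˡ _)
  kcoeff-++ ((c , u) ∷ a) b k =
    trans (cong ((if does (u ≟ k) then c else 0ℚ) ℚ.+_) (kcoeff-++ a b k))
      (sym (ℚP.+-assoc (if does (u ≟ k) then c else 0ℚ) (kcoeff a k) (kcoeff b k)))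

  kcoeff-scale : ∀ m a k → kcoeff (scaleLC m a) k ≡ m ℚ.* kcoeff a k
  kcoeff-scale m [] k = sym (ℚP.*-zeroʳ m)
  kcoeff-scale m ((c , u) ∷ a) k = trans (cong₂ ℚ._+_ (lift (does (u ≟ k))) (kcoeff-scale m a k))
    (sym (ℚP.*-distribˡ-+ m (if does (u ≟ k) then c else 0ℚ) (kcoeff a k)))
    where
    lift : ∀ d → (if d then m ℚ.* c else 0ℚ) ≡ m ℚ.* (if d then c else 0ℚ)
    lift true  = refl
    lift false = sym (ℚP.*-zeroʳ m)

  kcoeff-diff : ∀ a b k → kcoeff (a ++ scaleLC (ℚ.- 1ℚ) b) k ≡ kcoeff a k ℚ.- kcoeff b k
  kcoeff-diff a b k = trans (kcoeff-++ a _ k)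
    (cong (kcoeff a k ℚ.+_) (trans (kcoeff-scale (ℚ.- 1ℚ) b k)
      (trans (sym (ℚP.neg-distribˡ-* 1ℚ (kcoeff b k))) (cong ℚ.-_ (ℚP.*-identityˡ (kcoeff b k))))))

open Coefficients public

_≟R_ : DecidableEquality (List ℤ)
_≟R_ = LP.≡-dec ℤP._≟_

coeff-kcoeff : ∀ a u → coeff a u ≡ kcoeff _≟W_ a u
coeff-kcoeff [] u = refl
coeff-kcoeff ((c , w) ∷ a) u = cong ((if does (w ≟W u) then c else 0ℚ) ℚ.+_) (coeff-kcoeff a u)

mcoeff-kcoeff : ∀ a v → mcoeff a v ≡ kcoeff _≟R_ (mapKey mrow a) v
mcoeff-kcoeff [] v = refl
mcoeff-kcoeff ((c , w) ∷ a) v = cong ((if does (mrow w ≟R v) then c else 0ℚ) ℚ.+_) (mcoeff-kcoeff a v)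

-- Instantiated at ℚ and at the dual numbers. A semiring suffices because negative coefficients
-- enter only through `ι`.
record Scalars : Set₁ where
  field
    K : Set
    _+_ _*_ : K → K → K
    0# 1# : K
    isCommutativeSemiring : IsCommutativeSemiring _≡_ _+_ _*_ 0# 1#
    ι : ℚ → K
    ι-+ : ∀ a b → ι (a ℚ.+ b) ≡ (ι a + ι b)
    ι-* : ∀ a b → ι (a ℚ.* b) ≡ (ι a * ι b)
    ι-0 : ι 0ℚ ≡ 0#
    ι-1 : ι 1ℚ ≡ 1#
  infixl 6 _+_
  infixl 7 _*_
  open IsCommutativeSemiring isCommutativeSemiring public
    using (+-assoc; +-comm; +-identityˡ; +-identityʳ; *-assoc; *-comm; *-identityˡ; *-identityʳ; zeroˡ; zeroʳ; distribˡ; distribʳ)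

  commutativeSemiring : CommutativeSemiring _ _
  commutativeSemiring = record { isCommutativeSemiring = isCommutativeSemiring }

module Evaluation (S : Scalars) where
  open Scalars S
  open import Algebra.Solver.Ring.NaturalCoefficients.Default commutativeSemiring
    using (solve; _:=_; _:+_; _:*_)

  eval : {B : Set} → (B → K) → LC B → K
  eval f [] = 0#
  eval f ((c , b) ∷ a) = ι c * f b + eval f a

  module _ {B : Set} where

    eval-++ : ∀ (f : B → K) a b → eval f (a ++ b) ≡ eval f a + eval f b
    eval-++ f [] b = sym (+-identityˡ _)
    eval-++ f ((c , u) ∷ a) b =
      trans (cong ((ι c * f u) +_) (eval-++ f a b)) (sym (+-assoc _ _ _))

    eval-scale : ∀ (f : B → K) k a → eval f (scaleLC k a) ≡ ι k * eval f a
    eval-scale f k [] = sym (zeroʳ _)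
    eval-scale f k ((c , u) ∷ a) = begin
      ι (k ℚ.* c) * f u + eval f (scaleLC k a) ≡⟨ cong₂ (λ s t → s * f u + t) (ι-* k c) (eval-scale f k a) ⟩
      ι k * ι c * f u + ι k * eval f a         ≡⟨ solve 4 (λ k c x e → k :* c :* x :+ k :* e := k :* (c :* x :+ e)) refl (ι k) (ι c) (f u) (eval f a) ⟩
      ι k * (ι c * f u + eval f a)             ∎
      where open ≡-Reasoning

    eval-ext : ∀ {f g : B → K} → (∀ b → f b ≡ g b) → ∀ a → eval f a ≡ eval g a
    eval-ext f≗g [] = refl
    eval-ext f≗g ((c , b) ∷ a) = cong₂ (λ s t → ι c * s + t) (f≗g b) (eval-ext f≗g a)

    eval-0 : ∀ a → eval {B} (λ _ → 0#) a ≡ 0#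
    eval-0 [] = refl
    eval-0 ((c , b) ∷ a) = trans (cong₂ _+_ (zeroʳ _) (eval-0 a)) (+-identityˡ _)

    eval-+* : ∀ (f g : B → K) k a →
              eval (λ b → f b + k * g b) a ≡ eval f a + k * eval g a
    eval-+* f g k [] = sym (trans (+-identityˡ _) (zeroʳ _))
    eval-+* f g k ((c , b) ∷ a) = trans (cong ((ι c * (f b + k * g b)) +_) (eval-+* f g k a))
      (solve 6 (λ c k f g F G → c :* (f :+ k :* g) :+ (F :+ k :* G) := (c :* f :+ F) :+ k :* (c :* g :+ G))
        refl (ι c) k (f b) (g b) (eval f a) (eval g a))

  eval-mapKey : {B C : Set} (k : B → C) (f : C → K) → ∀ a → eval f (mapKey k a) ≡ eval (f ∘ k) a
  eval-mapKey k f [] = refl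
  eval-mapKey k f ((c , b) ∷ a) = cong ((ι c * f (k b)) +_) (eval-mapKey k f a)

  module Support {B : Set} (_≟_ : DecidableEquality B) where

    eval-split : ∀ (f : B → K) k a →
                 eval f a ≡ ι (kcoeff _≟_ a k) * f k + eval f (remove _≟_ k a)
    eval-split f k [] = sym (trans (+-identityʳ _) (trans (cong (_* f k) ι-0) (zeroˡ _)))
    eval-split f k ((c , b) ∷ a) with b ≟ k
    ... | yes refl = trans (cong ((ι c * f b) +_) (eval-split f b a))
          (trans (solve 4 (λ c x d e → c :* x :+ (d :* x :+ e) := (c :+ d) :* x :+ e) refl
                    (ι c) (f b) (ι (kcoeff _≟_ a b)) (eval f (remove _≟_ b a)))
                 (cong (λ s → s * f b + eval f (remove _≟_ b a)) (sym (ι-+ c (kcoeff _≟_ a b)))))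
    ... | no _ rewrite ℚP.+-identityˡ (kcoeff _≟_ a k) =
          trans (cong ((ι c * f b) +_) (eval-split f k a))
                (solve 3 (λ x y z → x :+ (y :+ z) := y :+ (x :+ z)) refl
                   (ι c * f b) (ι (kcoeff _≟_ a k) * f k) (eval f (remove _≟_ k a)))

    private
      eval-support′ : ∀ {P : B → Set} {f g : B → K} n a → length a ℕ.≤ n → Keys P a →
        (∀ b → P b → ι (kcoeff _≟_ a b) * f b ≡ ι (kcoeff _≟_ a b) * g b) → eval f a ≡ eval g a
      eval-support′ n [] _ _ _ = refl
      eval-support′ {P} {f} {g} (suc n) ((c , b) ∷ a) (s≤s l) ks@(p ∷ ps) h = begin
        eval f A                                              ≡⟨ eval-split f b A ⟩
        ι (kcoeff _≟_ A b) * f b + eval f (remove _≟_ b A)    ≡⟨ cong₂ _+_ (h b p) rest ⟩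
        ι (kcoeff _≟_ A b) * g b + eval g (remove _≟_ b A)    ≡⟨ eval-split g b A ⟨
        eval g A                                              ∎
        where
        open ≡-Reasoning
        A = (c , b) ∷ a
        h′ : ∀ j → P j → ι (kcoeff _≟_ (remove _≟_ b A) j) * f j ≡ ι (kcoeff _≟_ (remove _≟_ b A) j) * g j
        h′ j pj with j ≟ b
        ... | yes refl rewrite kcoeff-remove-self _≟_ b A | ι-0 = trans (zeroˡ _) (sym (zeroˡ _))
        ... | no j≢b rewrite kcoeff-remove-other _≟_ b A j≢b = h j pj
        rest : eval f (remove _≟_ b A) ≡ eval g (remove _≟_ b A)
        rest = eval-support′ n (remove _≟_ b A)
          (subst (ℕ._≤ n) (cong length (sym (remove-head _≟_ c b a))) (ℕP.≤-trans (length-remove _≟_ b a) l))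
          (keys-remove _≟_ b ks) h′

    -- Formal sums are not normalised: a key may occur several times and its coefficients may
    -- cancel. Collecting all occurrences of the first key and removing them shortens the list.
    -- Weighting by the total coefficient lets `f` and `g` differ on keys that cancel.
    eval-support : ∀ {P : B → Set} {f g : B → K} a → Keys P a →
      (∀ b → P b → ι (kcoeff _≟_ a b) * f b ≡ ι (kcoeff _≟_ a b) * g b) → eval f a ≡ eval g a
    eval-support a = eval-support′ (length a) a ℕP.≤-refl

  open Support public

  eval-≡0 : {B : Set} (_≟_ : DecidableEquality B) (f : B → K) → ∀ a →
            (∀ b → kcoeff _≟_ a b ≡ 0ℚ) → eval f a ≡ 0#
  eval-≡0 {B} _≟_ f a h = trans (eval-support _≟_ {P = λ _ → B} a (All.universal proj₂ a) λ b _ →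
      trans (cong (_* f b) (trans (cong ι (h b)) ι-0)) (trans (zeroˡ _) (sym (zeroʳ _))))
    (eval-0 a)

  -- The difference of `a` and `b`, formed with the coefficient -1, evaluates to 0; adding
  -- `eval f b` back replaces the cancellation that a semiring need not have.
  eval-resp : {B : Set} (_≟_ : DecidableEquality B) (f : B → K) → ∀ a b →
              (∀ k → kcoeff _≟_ a k ≡ kcoeff _≟_ b k) → eval f a ≡ eval f b
  eval-resp _≟_ f a b h = begin
    eval f a                                        ≡⟨ +-identityʳ _ ⟨
    eval f a + 0#                                   ≡⟨ cong (eval f a +_) cancel ⟨
    eval f a + (ι (ℚ.- 1ℚ) * eval f b + eval f b)   ≡⟨ +-assoc _ _ _ ⟨
    (eval f a + ι (ℚ.- 1ℚ) * eval f b) + eval f b   ≡⟨ cong (_+ eval f b) zero-diff ⟩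
    0# + eval f b                                   ≡⟨ +-identityˡ _ ⟩
    eval f b                                        ∎
    where
    open ≡-Reasoning
    zero-diff : eval f a + ι (ℚ.- 1ℚ) * eval f b ≡ 0#
    zero-diff = trans (cong (eval f a +_) (sym (eval-scale f (ℚ.- 1ℚ) b)))
      (trans (sym (eval-++ f a (scaleLC (ℚ.- 1ℚ) b))) (eval-≡0 _≟_ f (a ++ scaleLC (ℚ.- 1ℚ) b) λ k →
        trans (kcoeff-diff _≟_ a b k)
          (trans (cong (ℚ._- kcoeff _≟_ b k) (h k)) (ℚP.+-inverseʳ (kcoeff _≟_ b k)))))
    cancel : ι (ℚ.- 1ℚ) * eval f b + eval f b ≡ 0#
    cancel = begin
      ι (ℚ.- 1ℚ) * eval f b + eval f b           ≡⟨ cong ((ι (ℚ.- 1ℚ) * eval f b) +_) (trans (cong (_* eval f b) ι-1) (*-identityˡ _)) ⟨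
      ι (ℚ.- 1ℚ) * eval f b + ι 1ℚ * eval f b    ≡⟨ distribʳ _ _ _ ⟨
      (ι (ℚ.- 1ℚ) + ι 1ℚ) * eval f b             ≡⟨ cong (_* eval f b) (trans (sym (ι-+ (ℚ.- 1ℚ) 1ℚ)) ι-0) ⟩
      0# * eval f b                              ≡⟨ zeroˡ _ ⟩
      0#                                         ∎

-- Letters, rows and evaluated slide polynomials

infix 4 _≺_
_≺_ : Letter → Letter → Set
x ≺ y = val x ℤ.< val y ⊎ (val x ≡ val y × proj₂ x ℕ.< proj₂ y)

_≺?_ : ∀ x y → Dec (x ≺ y)
x ≺? y = (val x ℤP.<? val y) ⊎-dec ((val x ℤP.≟ val y) ×-dec (proj₂ x ℕP.<? proj₂ y))

≺⇒<L : ∀ x y → x ≺ y → x <L y ≡ true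
≺⇒<L x y = dec-true (x ≺? y)

⊀⇒≮L : ∀ x y → ¬ x ≺ y → x <L y ≡ false
⊀⇒≮L x y = dec-false (x ≺? y)

<L⇒≺ : ∀ x y → x <L y ≡ true → x ≺ y
<L⇒≺ x y h with x ≺? y
... | yes p = p
... | no ¬p with trans (sym h) (⊀⇒≮L x y ¬p)
... | ()

≺-trans : ∀ {x y z} → x ≺ y → y ≺ z → x ≺ z
≺-trans (inj₁ p) (inj₁ q) = inj₁ (ℤP.<-trans p q)
≺-trans (inj₁ p) (inj₂ (refl , _)) = inj₁ p
≺-trans (inj₂ (refl , _)) (inj₁ q) = inj₁ q
≺-trans (inj₂ (refl , p)) (inj₂ (refl , q)) = inj₂ (refl , ℕP.<-trans p q)

≺-irrefl : ∀ {x} → ¬ x ≺ x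
≺-irrefl (inj₁ p) = ℤP.<-irrefl refl p
≺-irrefl (inj₂ (_ , p)) = ℕP.<-irrefl refl p

≺-connex : ∀ x y → x ≢ y → x ≺ y ⊎ y ≺ x
≺-connex (v , c) (w , d) x≢y with ℤP.<-cmp v w
... | tri< p _ _ = inj₁ (inj₁ p)
... | tri> _ _ p = inj₂ (inj₁ p)
... | tri≈ _ refl _ with ℕP.<-cmp c d
... | tri< p _ _ = inj₁ (inj₂ (refl , p))
... | tri> _ _ p = inj₂ (inj₂ (refl , p))
... | tri≈ _ refl _ = ⊥-elim (x≢y refl)

Disjoint : Word → Word → Set
Disjoint p q = All (λ x → All (x ≢_) q) p

colours-below : ∀ p → All (λ x → proj₂ x ℕ.< maxcol p) p
colours-below [] = []
colours-below (x ∷ p) = ℕP.m≤m⊔n (colour x) (maxcol p)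
  ∷ All.map (λ h → ℕP.≤-trans h (ℕP.m≤n⊔m (colour x) (maxcol p))) (colours-below p)

-- This is what the colour shift achieves: `proj₂` of a letter of `p` stays below `maxcol p`, while
-- that of every shifted letter reaches it.
disjoint-↑ : ∀ p q → Disjoint p (q ↑ maxcol p)
disjoint-↑ p q = All.map (λ x<m → AllP.map⁺ (All.universal
    (λ { (v , c) refl → ℕP.<⇒≱ x<m (ℕP.m≤n+m (maxcol p) c) }) q))
  (colours-below p)

allowed : Maybe Letter → Letter → Bool
allowed nothing  z = true
allowed (just b) z = not (b <L z)

allowed-down : ∀ b {x y} → y ≺ x → allowed b x ≡ true → allowed b y ≡ true
allowed-down nothing _ _ = refl
allowed-down (just b) {x} {y} y≺x h with b ≺? y
... | no b⊀y rewrite ⊀⇒≮L b y b⊀y = refl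
... | yes b≺y with trans (sym (cong not (≺⇒<L b x (≺-trans b≺y y≺x)))) h
... | ()

ok : ℤ → Maybe Letter → Letter → Bool
ok L b z = does (L ℤP.≤? val z) ∧ allowed b z

emb : List ℤ → Word
emb = map (_, 0)

-- `mrow` unfolds through a private function; `Row` exposes its recursion.
data Row : Word → List ℤ → Set where
  nil    : Row [] []
  one    : ∀ {t} → Row (t ∷ []) (val t ∷ [])
  weak   : ∀ {t t′ ts m ms} → t <L t′ ≡ false → Row (t′ ∷ ts) (m ∷ ms) →
           Row (t ∷ t′ ∷ ts) (m ∷ m ∷ ms)
  strict : ∀ {t t′ ts m ms} → t <L t′ ≡ true → Row (t′ ∷ ts) (m ∷ ms) →
           Row (t ∷ t′ ∷ ts) (val t ℤ.⊓ (m ℤ.- ℤ.1ℤ) ∷ m ∷ ms)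

row : ∀ p → Row p (mrow p)
row [] = nil
row (t ∷ []) = one
row (t ∷ t′ ∷ ts) with mrow (t′ ∷ ts) | row (t′ ∷ ts)
... | m ∷ ms | r with t <L t′ in eq
... | true  = strict eq r
... | false = weak eq r

-- Evaluations of slide polynomials: `F L xs p` is the slide polynomial of `p`
-- in the variables x_L, x_{L+1}, …, at the point `xs` (all other variables 0).
-- `W` sums over the weakly decreasing prefixes, with letters of value ≥ L,
-- to which the smallest index L is assigned.
module Slides (S : Scalars) where
  open Scalars S
  open Evaluation S
  open import Algebra.Solver.Ring.NaturalCoefficients.Default commutativeSemiring
    using (solve; _:=_; _:+_; _:*_)

  W : ℤ → K → (Word → K) → Maybe Letter → Word → K
  W L x g b [] = g []
  W L x g b (z ∷ p) = g (z ∷ p) + (if ok L b z then x * W L x g (just z) p else 0#)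

  F : ∀ {n} → ℤ → Vec K n → Word → K
  F L [] [] = 1#
  F L [] (_ ∷ _) = 0#
  F L (x ∷ xs) p = W L x (F (ℤ.suc L) xs) nothing p

  Σw : (Word → K) → List Word → K
  Σw f [] = 0#
  Σw f (w ∷ ws) = f w + Σw f ws

  Σw-++ : ∀ f ws vs → Σw f (ws ++ vs) ≡ Σw f ws + Σw f vs
  Σw-++ f [] vs = sym (+-identityˡ _)
  Σw-++ f (w ∷ ws) vs = trans (cong (f w +_) (Σw-++ f ws vs)) (sym (+-assoc _ _ _))

  -- Disjointness excludes ties: of two equal first letters neither would end a run started by the
  -- other, and a merged run would be counted more than once.
  Multiplicative : (Word → K) → Set
  Multiplicative f = ∀ p q → Disjoint p q → Σw f (shuffle p q) ≡ f p * f q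

  record Character (f : Word → K) : Set where
    field
      unit-1         : f [] ≡ 1#
      multiplicative : Multiplicative f
      shift          : ∀ k p → f (p ↑ k) ≡ f p

  disjoint-tailʳ : ∀ {p y q} → Disjoint p (y ∷ q) → Disjoint p q
  disjoint-tailʳ = All.map λ { (_ ∷ h) → h }

  module _ (L : ℤ) (t : K) (g : Word → K) where
    private
      w : Maybe Letter → Word → K
      w = W L t g
      rest : Maybe Letter → Letter → Word → K
      rest b z p = if ok L b z then t * w (just z) p else 0#

    W-cut : ∀ {x y} p → y ≺ x → w (just y) (x ∷ p) ≡ g (x ∷ p)
    W-cut {x} {y} p y≺x rewrite ≺⇒<L y x y≺x with does (L ℤP.≤? val x)
    ... | true  = +-identityʳ _
    ... | false = +-identityʳ _

    W-free : ∀ b {x y} q → y ≺ x → ok L b x ≡ true → w (just x) (y ∷ q) ≡ w b (y ∷ q)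
    W-free b {x} {y} q y≺x okx rewrite ⊀⇒≮L x y (λ x≺y → ≺-irrefl (≺-trans x≺y y≺x))
      with does (L ℤP.≤? val x) | okx
    ... | true | b⊀x rewrite allowed-down b y≺x b⊀x = refl

    Σw-W : ∀ b x ws → Σw (w b) (map (x ∷_) ws) ≡
           Σw g (map (x ∷_) ws) + (if ok L b x then t * Σw (w (just x)) ws else 0#)
    Σw-W b x [] with ok L b x
    ... | true  = sym (trans (+-identityˡ _) (zeroʳ t))
    ... | false = sym (+-identityˡ _)
    Σw-W b x (v ∷ ws) with ok L b x | Σw-W b x ws
    ... | true  | ih = trans (cong (_ +_) ih)
          (solve 5 (λ t a u A U → (a :+ t :* u) :+ (A :+ t :* U) := (a :+ A) :+ t :* (u :+ U)) refl
            t (g (x ∷ v)) (w (just x) v) (Σw g (map (x ∷_) ws)) (Σw (w (just x)) ws))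
    ... | false | ih rewrite +-identityʳ (g (x ∷ v)) | +-identityʳ (Σw g (map (x ∷_) ws))
          | +-identityʳ (g (x ∷ v) + Σw g (map (x ∷_) ws)) = cong (g (x ∷ v) +_) ih

    -- Two weakly decreasing prefixes over disjoint letters merge into exactly one weakly decreasing
    -- prefix, and what follows is an interlacing of the two remainders, on which `g` is
    -- multiplicative. In the recursion, the larger first letter in front leaves the run of the
    -- other word free (`W-free`), and the smaller one in front ends it (`W-cut`).
    W-multiplicative : g [] ≡ 1# → Multiplicative g → ∀ b → Multiplicative (w b)
    W-multiplicative g1 gm b [] q dj =
      trans (+-identityʳ _) (sym (trans (cong (_* w b q) g1) (*-identityˡ _)))
    W-multiplicative g1 gm b (x ∷ p) [] dj =
      trans (+-identityʳ _) (sym (trans (cong (w b (x ∷ p) *_) g1) (*-identityʳ _)))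
    W-multiplicative g1 gm b (x ∷ p) (y ∷ q) dj@((x≢y ∷ xq) ∷ dp) = begin
      Σw (w b) (map (x ∷_) A ++ map (y ∷_) B)
        ≡⟨ Σw-++ (w b) (map (x ∷_) A) (map (y ∷_) B) ⟩
      Σw (w b) (map (x ∷_) A) + Σw (w b) (map (y ∷_) B)
        ≡⟨ cong₂ _+_ (Σw-W b x A) (Σw-W b y B) ⟩
      (Σw g (map (x ∷_) A) + (if ok L b x then t * Σw (w (just x)) A else 0#)) +
      (Σw g (map (y ∷_) B) + (if ok L b y then t * Σw (w (just y)) B else 0#))
        ≡⟨ solve 4 (λ a c d e → (a :+ c) :+ (d :+ e) := (a :+ d) :+ (c :+ e)) refl _ _ _ _ ⟩
      (Σw g (map (x ∷_) A) + Σw g (map (y ∷_) B)) +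
      ((if ok L b x then t * Σw (w (just x)) A else 0#) + (if ok L b y then t * Σw (w (just y)) B else 0#))
        ≡⟨ cong₂ _+_ (trans (sym (Σw-++ g (map (x ∷_) A) (map (y ∷_) B))) (gm (x ∷ p) (y ∷ q) dj))
             (cong₂ (λ u v → (if ok L b x then t * u else 0#) + (if ok L b y then t * v else 0#))
               (W-multiplicative g1 gm (just x) p (y ∷ q) dp)
               (W-multiplicative g1 gm (just y) (x ∷ p) q (disjoint-tailʳ dj))) ⟩
      G + ((if ok L b x then t * (w (just x) p * w (just x) (y ∷ q)) else 0#)
         + (if ok L b y then t * (w (just y) (x ∷ p) * w (just y) q) else 0#))
        ≡⟨ merge (≺-connex x y x≢y) ⟩
      w b (x ∷ p) * w b (y ∷ q) ∎
      where
      open ≡-Reasoning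
      A = shuffle p (y ∷ q)
      B = shuffle (x ∷ p) q
      G = g (x ∷ p) * g (y ∷ q)
      if-* : ∀ c u v s → u ≡ v → (if c then t * (s * u) else 0#) ≡ (if c then t * s else 0#) * v
      if-* true  u v s u≡v = trans (sym (*-assoc t s u)) (cong (t * s *_) u≡v)
      if-* false u v s u≡v = sym (zeroˡ v)
      if-*-ok : ∀ c u v s → (c ≡ true → u ≡ v) → (if c then t * (s * u) else 0#) ≡ (if c then t * s else 0#) * v
      if-*-ok true  u v s h = if-* true u v s (h refl)
      if-*-ok false u v s h = sym (zeroˡ v)
      swap : ∀ c u s → (if c then t * (u * s) else 0#) ≡ (if c then t * (s * u) else 0#)
      swap true u s = cong (t *_) (*-comm u s)
      swap false u s = refl
      merge : x ≺ y ⊎ y ≺ x → _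
      merge (inj₂ y≺x) = trans (cong (G +_) (cong₂ _+_
          (if-*-ok (ok L b x) _ (w b (y ∷ q)) (w (just x) p) (W-free b q y≺x))
          (trans (swap (ok L b y) _ _) (if-* (ok L b y) _ _ (w (just y) q) (W-cut p y≺x)))))
        (solve 4 (λ a c X Y → a :* c :+ (X :* (c :+ Y) :+ Y :* a) := (a :+ X) :* (c :+ Y)) refl
          (g (x ∷ p)) (g (y ∷ q)) (rest b x p) (rest b y q))
      merge (inj₁ x≺y) = trans (cong (G +_) (cong₂ _+_
          (if-* (ok L b x) _ _ (w (just x) p) (W-cut q x≺y))
          (trans (swap (ok L b y) _ _) (if-*-ok (ok L b y) _ (w b (x ∷ p)) (w (just y) q) (W-free b p x≺y)))))
        (solve 4 (λ a c X Y → a :* c :+ (X :* c :+ Y :* (a :+ X)) := (a :+ X) :* (c :+ Y)) refl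
          (g (x ∷ p)) (g (y ∷ q)) (rest b x p) (rest b y q))

  shiftL : ℕ → Letter → Letter
  shiftL k l = val l , proj₂ l ℕ.+ k

  shift-<L : ∀ k x y → shiftL k x <L shiftL k y ≡ x <L y
  shift-<L k x y with x ≺? y
  ... | yes x≺y = trans (≺⇒<L (shiftL k x) (shiftL k y) (up x≺y)) (sym (≺⇒<L x y x≺y))
    where
    up : x ≺ y → shiftL k x ≺ shiftL k y
    up (inj₁ h) = inj₁ h
    up (inj₂ (e , h)) = inj₂ (e , ℕP.+-monoˡ-< k h)
  ... | no x⊀y = trans (⊀⇒≮L (shiftL k x) (shiftL k y) (x⊀y ∘ down)) (sym (⊀⇒≮L x y x⊀y))
    where
    down : shiftL k x ≺ shiftL k y → x ≺ y
    down (inj₁ h) = inj₁ h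
    down (inj₂ (e , h)) = inj₂ (e , ℕP.+-cancelʳ-< k _ _ h)

  shift-ok : ∀ k L b z → ok L (Maybe.map (shiftL k) b) (shiftL k z) ≡ ok L b z
  shift-ok k L nothing z = refl
  shift-ok k L (just b) z = cong (λ c → does (L ℤP.≤? val z) ∧ not c) (shift-<L k b z)

  W-shift : ∀ L x g k → (∀ p → g (p ↑ k) ≡ g p) → ∀ b p →
            W L x g (Maybe.map (shiftL k) b) (p ↑ k) ≡ W L x g b p
  W-shift L x g k gs b [] = gs []
  W-shift L x g k gs b (z ∷ p) = cong₂ _+_ (gs (z ∷ p))
    (cong₂ (λ c s → if c then x * s else 0#) (shift-ok k L b z) (W-shift L x g k gs (just z) p))

  F-character : ∀ {n} L (xs : Vec K n) → Character (F L xs)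
  F-character L [] = record
    { unit-1 = refl
    ; multiplicative = mult
    ; shift = λ { k [] → refl ; k (_ ∷ _) → refl } }
    where
    vanish : ∀ x ws → Σw (F L []) (map (x ∷_) ws) ≡ 0#
    vanish x [] = refl
    vanish x (w ∷ ws) = trans (+-identityˡ _) (vanish x ws)
    mult : Multiplicative (F L [])
    mult [] q _ = trans (+-identityʳ _) (sym (*-identityˡ _))
    mult (x ∷ p) [] _ = trans (+-identityʳ _) (sym (*-identityʳ _))
    mult (x ∷ p) (y ∷ q) _ = trans (Σw-++ (F L []) (map (x ∷_) (shuffle p (y ∷ q))) _)
      (trans (cong₂ _+_ (vanish x (shuffle p (y ∷ q))) (vanish y (shuffle (x ∷ p) q)))
        (trans (+-identityˡ _) (sym (zeroˡ _))))
  F-character L (x ∷ xs) = record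
    { unit-1 = unit-1
    ; multiplicative = W-multiplicative L x g unit-1 multiplicative nothing
    ; shift = λ k p → W-shift L x g k (shift k) nothing p }
    where
    g = F (ℤ.suc L) xs
    open Character (F-character (ℤ.suc L) xs)

  eval-Σw : ∀ f ws → eval f (map (1ℚ ,_) ws) ≡ Σw f ws
  eval-Σw f [] = refl
  eval-Σw f (w ∷ ws) = cong₂ _+_ (trans (cong (_* f w) ι-1) (*-identityˡ _)) (eval-Σw f ws)

  module _ {f : Word → K} (χ : Character f) where
    open Character χ

    eval-wordMul : ∀ p q → eval f (wordMul p q) ≡ f p * f q
    eval-wordMul p q = begin
      eval f (wordMul p q)              ≡⟨ eval-Σw f (shuffle p (q ↑ maxcol p)) ⟩
      Σw f (shuffle p (q ↑ maxcol p))   ≡⟨ multiplicative p (q ↑ maxcol p) (disjoint-↑ p q) ⟩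
      f p * f (q ↑ maxcol p)            ≡⟨ cong (f p *_) (shift (maxcol p) q) ⟩
      f p * f q                         ∎
      where open ≡-Reasoning

    private
      mulTerm : ℚ × Word → ℚ × Word → 𝒬
      mulTerm s t = scale (proj₁ s ℚ.* proj₁ t) (wordMul (proj₂ s) (proj₂ t))

      eval-mulTerm : ∀ c p d q → eval f (mulTerm (c , p) (d , q)) ≡ ι c * f p * (ι d * f q)
      eval-mulTerm c p d q = trans (eval-scale f (c ℚ.* d) (wordMul p q))
        (trans (cong₂ _*_ (ι-* c d) (eval-wordMul p q))
          (solve 4 (λ c d x y → c :* d :* (x :* y) := c :* x :* (d :* y)) refl (ι c) (ι d) (f p) (f q)))

      eval-mulRow : ∀ c p b → eval f (concatMap (mulTerm (c , p)) b) ≡ ι c * f p * eval f b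
      eval-mulRow c p [] = sym (zeroʳ _)
      eval-mulRow c p ((d , q) ∷ b) = trans (eval-++ f (mulTerm (c , p) (d , q)) _)
        (trans (cong₂ _+_ (eval-mulTerm c p d q) (eval-mulRow c p b)) (sym (distribˡ _ _ _)))

    eval-⊛ : ∀ a b → eval f (a ⊛ b) ≡ eval f a * eval f b
    eval-⊛ [] b = sym (zeroˡ _)
    eval-⊛ ((c , p) ∷ a) b = trans (eval-++ f (concatMap (mulTerm (c , p)) b) _)
      (trans (cong₂ _+_ (eval-mulRow c p b) (eval-⊛ a b)) (sym (distribʳ _ _ _)))

-- Dependence of slide polynomials on the maximal bottom row alone

suc[i-1] : ∀ i → ℤ.suc (i ℤ.- ℤ.1ℤ) ≡ i
suc[i-1] i = trans (cong ℤ.suc (ℤP.+-comm i ℤ.-1ℤ)) (ℤP.suc-pred i)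

i<suc[i] : ∀ i → i ℤ.< ℤ.suc i
i<suc[i] i = ℤP.suc[i]≤j⇒i<j ℤP.≤-refl

row≤val : ∀ {z p m ms} → Row (z ∷ p) (m ∷ ms) → m ℤ.≤ val z
row≤val one = ℤP.≤-refl
row≤val (weak {t} {t′} t≮t′ r) with ℤP.<-cmp (val t) (val t′)
... | tri> _ _ t′<t = ℤP.≤-trans (row≤val r) (ℤP.<⇒≤ t′<t)
... | tri≈ _ t≡t′ _ = ℤP.≤-trans (row≤val r) (ℤP.≤-reflexive (sym t≡t′))
... | tri< t<t′ _ _ with trans (sym t≮t′) (≺⇒<L t t′ (inj₁ t<t′))
... | ()
row≤val (strict {t} {m = m} _ _) = ℤP.i⊓j≤i (val t) (m ℤ.- ℤ.1ℤ)

module RowInvariance (S : Scalars) where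
  open Scalars S
  open Slides S

  Vanishing : ℤ → (Word → K) → Set
  Vanishing L g = ∀ {p m ms} → Row p (m ∷ ms) → m ℤ.< L → g p ≡ 0#

  RowInvariant : (Word → K) → Set
  RowInvariant g = ∀ {p r} → Row p r → g p ≡ g (emb r)

  if-0 : ∀ x c → (if c then x * 0# else 0#) ≡ 0#
  if-0 x true  = zeroʳ x
  if-0 x false = refl

  module _ (L : ℤ) (x : K) (g : Word → K) (gv : Vanishing (ℤ.suc L) g) where

    -- The first row entry is the largest index that the first letter can receive. At an ascent,
    -- either the letter itself is below `L`, or the next letter has an entry of at most `L` and
    -- cannot receive the larger index that it needs.
    W-vanishing : ∀ b → Vanishing L (W L x g b)
    W-vanishing b {z ∷ p} r m<L = trans
      (cong₂ _+_ (gv r (ℤP.<-trans m<L (i<suc[i] L))) (tail r m<L)) (+-identityˡ _)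
      where
      tail : ∀ {z p m ms} → Row (z ∷ p) (m ∷ ms) → m ℤ.< L →
             (if ok L b z then x * W L x g (just z) p else 0#) ≡ 0#
      tail {z} one z<L rewrite dec-false (L ℤP.≤? val z) (ℤP.<⇒≱ z<L) = refl
      tail {z} {p} (weak _ r) m<L = trans
        (cong (λ s → if ok L b z then x * s else 0#) (W-vanishing (just z) r m<L)) (if-0 x (ok L b z))
      tail {z} (strict {t′ = t′} {ts} {m} z<t′ r) m<L with L ℤP.≤? val z
      ... | no _ = refl
      ... | yes L≤z = trans (cong (λ s → if allowed b z then x * s else 0#)
              (trans (W-cut L x g ts (<L⇒≺ z t′ z<t′)) (gv r m<suc[L]))) (if-0 x (allowed b z))
        where
        m-1<L : m ℤ.- ℤ.1ℤ ℤ.< L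
        m-1<L with ℤP.⊓-sel (val z) (m ℤ.- ℤ.1ℤ)
        ... | inj₁ e = ⊥-elim (ℤP.<⇒≱ m<L (subst (L ℤ.≤_) (sym e) L≤z))
        ... | inj₂ e = subst (ℤ._< L) e m<L
        m<suc[L] : m ℤ.< ℤ.suc L
        m<suc[L] = subst (ℤ._< ℤ.suc L) (suc[i-1] m) (ℤP.+-monoʳ-< ℤ.1ℤ m-1<L)

    -- A word and its row have ascents at the same places, so their runs correspond. The conditions
    -- `L ≤ val z` and `L ≤ m` can differ only if `m` is below `L`, and then both sides vanish.
    W-row : RowInvariant g → ∀ b b′ {z p m ms} → Row (z ∷ p) (m ∷ ms) →
            allowed b z ≡ allowed b′ (m , 0) → W L x g b (z ∷ p) ≡ W L x g b′ (emb (m ∷ ms))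
    W-row gr b b′ {z} {p} {m} {ms} r eq with L ℤP.≤? m
    ... | no L≰m = trans (W-vanishing b r (ℤP.≰⇒> L≰m))
          (sym (trans (+-identityʳ _) (trans (sym (gr r)) (gv r (ℤP.<-trans (ℤP.≰⇒> L≰m) (i<suc[i] L))))))
    ... | yes L≤m rewrite dec-true (L ℤP.≤? val z) (ℤP.≤-trans L≤m (row≤val r)) | eq =
          cong₂ _+_ (gr r) (cong (λ s → if allowed b′ (m , 0) then x * s else 0#) (next r))
      where
      next : ∀ {z p m ms} → Row (z ∷ p) (m ∷ ms) → W L x g (just z) p ≡ W L x g (just (m , 0)) (emb ms)
      next one = refl
      next {z} {m = m} (weak z≮t′ r) = W-row gr (just z) (just (m , 0)) r
        (cong not (trans z≮t′ (sym (⊀⇒≮L (m , 0) (m , 0) ≺-irrefl))))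
      next {z} (strict {m = m} z<t′ r) = W-row gr (just z) (just (val z ℤ.⊓ (m ℤ.- ℤ.1ℤ) , 0)) r
        (cong not (trans z<t′ (sym (≺⇒<L (val z ℤ.⊓ (m ℤ.- ℤ.1ℤ) , 0) (m , 0)
          (inj₁ (ℤP.≤-<-trans (ℤP.i⊓j≤j (val z) (m ℤ.- ℤ.1ℤ))
            (subst (m ℤ.- ℤ.1ℤ ℤ.<_) (suc[i-1] m) (i<suc[i] _))))))))

  F-vanishing : ∀ {n} L (xs : Vec K n) → Vanishing L (F L xs)
  F-vanishing L [] {_ ∷ _} r m<L = refl
  F-vanishing L (x ∷ xs) = W-vanishing L x _ (F-vanishing (ℤ.suc L) xs) nothing

  F-row : ∀ {n} L (xs : Vec K n) → RowInvariant (F L xs)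
  F-row L xs nil = refl
  F-row L [] one = refl
  F-row L [] (weak _ _) = refl
  F-row L [] (strict _ _) = refl
  F-row L (x ∷ xs) {_ ∷ _} {_ ∷ _} r =
    W-row L x _ (F-vanishing (ℤ.suc L) xs) (F-row (ℤ.suc L) xs) nothing nothing r refl

-- The nilCoxeter algebra, acting on functions ρ of integer words: the
-- generator u_i sends ρ to ρ ∘ (i ∷_), and a product of generators is applied
-- from left to right.
module NilCoxeter (S : Scalars) where
  open Scalars S
  open import Algebra.Solver.Ring.NaturalCoefficients.Default commutativeSemiring
    using (solve; _:=_; _:+_; _:*_; con)

  Fn : Set
  Fn = List ℤ → K

  -- These functions are the linear forms on the nilCoxeter algebra; they stand in for the quotient
  -- by its relations.
  record Nil (ρ : Fn) : Set where
    field
      square : ∀ p i q → ρ (p ++ i ∷ i ∷ q) ≡ 0#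
      comm   : ∀ p {i j} q → ℤ.suc i ℤ.< j → ρ (p ++ i ∷ j ∷ q) ≡ ρ (p ++ j ∷ i ∷ q)
      braid  : ∀ p i q → ρ (p ++ i ∷ ℤ.suc i ∷ i ∷ q) ≡ ρ (p ++ ℤ.suc i ∷ i ∷ ℤ.suc i ∷ q)
  open Nil

  record Linear (Q : Fn → K) : Set where
    field
      lin-cong : ∀ {ρ σ} → (∀ p → ρ p ≡ σ p) → Q ρ ≡ Q σ
      lin-+    : ∀ ρ σ → Q (λ p → ρ p + σ p) ≡ Q ρ + Q σ
      lin-*    : ∀ k ρ → Q (λ p → k * ρ p) ≡ k * Q ρ
  open Linear

  lin-+* : ∀ {Q} → Linear Q → ∀ ρ k σ → Q (λ p → ρ p + k * σ p) ≡ Q ρ + k * Q σ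
  lin-+* {Q} l ρ k σ = trans (lin-+ l ρ (λ p → k * σ p)) (cong (Q ρ +_) (lin-* l k σ))

  lin-0 : ∀ {Q} → Linear Q → Q (λ _ → 0#) ≡ 0#
  lin-0 l = trans (lin-cong l (λ _ → sym (zeroˡ 0#))) (trans (lin-* l 0# (λ _ → 0#)) (zeroˡ _))

  linear-at : ∀ p → Linear (λ ρ → ρ p)
  linear-at p = record { lin-cong = λ h → h p ; lin-+ = λ _ _ → refl ; lin-* = λ _ _ → refl }

  linear-0 : Linear (λ _ → 0#)
  linear-0 = record
    { lin-cong = λ _ → refl ; lin-+ = λ _ _ → sym (+-identityˡ 0#) ; lin-* = λ k _ → sym (zeroʳ k) }

  linear-+* : ∀ {Q R} k → Linear Q → Linear R → Linear (λ ρ → Q ρ + k * R ρ)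
  linear-+* {Q} {R} k lQ lR = record
    { lin-cong = λ h → cong₂ (λ s t → s + k * t) (lin-cong lQ h) (lin-cong lR h)
    ; lin-+ = λ ρ σ → trans (cong₂ (λ s t → s + k * t) (lin-+ lQ ρ σ) (lin-+ lR ρ σ))
        (solve 5 (λ k a b c d → (a :+ b) :+ k :* (c :+ d) := (a :+ k :* c) :+ (b :+ k :* d)) refl
          k (Q ρ) (Q σ) (R ρ) (R σ))
    ; lin-* = λ m ρ → trans (cong₂ (λ s t → s + k * t) (lin-* lQ m ρ) (lin-* lR m ρ))
        (solve 4 (λ k m a b → m :* a :+ k :* (m :* b) := m :* (a :+ k :* b)) refl k m (Q ρ) (R ρ)) }

  linear-+ : ∀ {Q R} → Linear Q → Linear R → Linear (λ ρ → Q ρ + R ρ)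
  linear-+ {Q} {R} lQ lR = record
    { lin-cong = λ h → cong₂ _+_ (lin-cong lQ h) (lin-cong lR h)
    ; lin-+ = λ ρ σ → trans (cong₂ _+_ (lin-+ lQ ρ σ) (lin-+ lR ρ σ))
        (solve 4 (λ a b c d → (a :+ b) :+ (c :+ d) := (a :+ c) :+ (b :+ d)) refl
          (Q ρ) (Q σ) (R ρ) (R σ))
    ; lin-* = λ m ρ → trans (cong₂ _+_ (lin-* lQ m ρ) (lin-* lR m ρ)) (sym (distribˡ m (Q ρ) (R ρ))) }

  linear-∘ : ∀ {Q} {O : Fn → Fn} → Linear Q → (∀ p → Linear (λ ρ → O ρ p)) → Linear (λ ρ → Q (O ρ))
  linear-∘ {Q} {O} lQ lO = record
    { lin-cong = λ h → lin-cong lQ (λ p → lin-cong (lO p) h)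
    ; lin-+ = λ ρ σ → trans (lin-cong lQ (λ p → lin-+ (lO p) ρ σ)) (lin-+ lQ (O ρ) (O σ))
    ; lin-* = λ k ρ → trans (lin-cong lQ (λ p → lin-* (lO p) k ρ)) (lin-* lQ k (O ρ)) }

  -- 1 + x u_i
  T : ℤ → K → Fn → Fn
  T i x ρ p = ρ p + x * ρ (i ∷ p)

  -- (1 + x u_{i+c-1}) ⋯ (1 + x u_{i+1}) (1 + x u_i)
  A : ℤ → ℕ → K → Fn → Fn
  A i zero    x ρ = ρ
  A i (suc c) x ρ = T i x (A (ℤ.suc i) c x ρ)

  -- u_i + u_{i+1} + ⋯ + u_{i+c-1}
  U : ℤ → ℕ → Fn → Fn
  U i zero    ρ p = 0#
  U i (suc c) ρ p = ρ (i ∷ p) + U (ℤ.suc i) c ρ p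

  -- u_i + 2 u_{i+1} + ⋯ + c u_{i+c-1}
  E : ℤ → ℕ → Fn → Fn
  E i zero    ρ p = 0#
  E i (suc c) ρ p = U i (suc c) ρ p + E (ℤ.suc i) c ρ p

  -- The value of `ρ` on the Fomin-Stanley product A_i(x_i) A_{i+1}(x_{i+1}) ⋯, in which all factors
  -- start with the same highest generator.
  P : ∀ {n} → ℤ → Vec K n → Fn → K
  P i [] ρ = ρ []
  P {suc n} i (x ∷ xs) ρ = P (ℤ.suc i) xs (A i (suc n) x ρ)

  T-linear : ∀ i x p → Linear (λ ρ → T i x ρ p)
  T-linear i x p = linear-+* x (linear-at p) (linear-at (i ∷ p))

  A-linear : ∀ i c x p → Linear (λ ρ → A i c x ρ p)
  A-linear i zero x p = linear-at p
  A-linear i (suc c) x p = linear-+* x (A-linear (ℤ.suc i) c x p) (A-linear (ℤ.suc i) c x (i ∷ p))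

  U-linear : ∀ i c p → Linear (λ ρ → U i c ρ p)
  U-linear i zero p = linear-0
  U-linear i (suc c) p = linear-+ (linear-at (i ∷ p)) (U-linear (ℤ.suc i) c p)

  E-linear : ∀ i c p → Linear (λ ρ → E i c ρ p)
  E-linear i zero p = linear-0
  E-linear i (suc c) p = linear-+ (U-linear i (suc c) p) (E-linear (ℤ.suc i) c p)

  P-linear : ∀ {n} i (xs : Vec K n) → Linear (P i xs)
  P-linear i [] = linear-at []
  P-linear {suc n} i (x ∷ xs) = linear-∘ (P-linear (ℤ.suc i) xs) (A-linear i (suc n) x)

  Nil-u : ∀ {ρ} i → Nil ρ → Nil (ρ ∘ (i ∷_))
  Nil-u i ν = record
    { square = λ p → square ν (i ∷ p) ; comm = λ p → comm ν (i ∷ p) ; braid = λ p → braid ν (i ∷ p) }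

  Nil-+* : ∀ {ρ σ} k → Nil ρ → Nil σ → Nil (λ p → ρ p + k * σ p)
  Nil-+* k ν μ = record
    { square = λ p i q → trans (cong₂ (λ s t → s + k * t) (square ν p i q) (square μ p i q))
        (trans (+-identityˡ _) (zeroʳ k))
    ; comm = λ p q h → cong₂ (λ s t → s + k * t) (comm ν p q h) (comm μ p q h)
    ; braid = λ p i q → cong₂ (λ s t → s + k * t) (braid ν p i q) (braid μ p i q) }

  Nil-+ : ∀ {ρ σ} → Nil ρ → Nil σ → Nil (λ p → ρ p + σ p)
  Nil-+ ν μ = record
    { square = λ p i q → trans (cong₂ _+_ (square ν p i q) (square μ p i q)) (+-identityˡ _)
    ; comm = λ p q h → cong₂ _+_ (comm ν p q h) (comm μ p q h)
    ; braid = λ p i q → cong₂ _+_ (braid ν p i q) (braid μ p i q) }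

  Nil-A : ∀ {ρ} i c x → Nil ρ → Nil (A i c x ρ)
  Nil-A i zero x ν = ν
  Nil-A i (suc c) x ν = Nil-+* x (Nil-A (ℤ.suc i) c x ν) (Nil-u i (Nil-A (ℤ.suc i) c x ν))

  Nil-U : ∀ {ρ} i c → Nil ρ → Nil (U i c ρ)
  Nil-U i zero ν = record { square = λ _ _ _ → refl ; comm = λ _ _ _ → refl ; braid = λ _ _ _ → refl }
  Nil-U i (suc c) ν = Nil-+ (Nil-u i ν) (Nil-U (ℤ.suc i) c ν)

  A-u : ∀ {ρ i} j c x → Nil ρ → ℤ.suc i ℤ.< j → ∀ p → A j c x (ρ ∘ (i ∷_)) p ≡ A j c x ρ (i ∷ p)
  A-u j zero x ν i≪j p = refl
  A-u {ρ} {i} j (suc c) x ν i≪j p = cong₂ (λ s t → s + x * t) (ih p)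
    (trans (ih (j ∷ p)) (comm (Nil-A (ℤ.suc j) c x ν) [] p i≪j))
    where ih = A-u (ℤ.suc j) c x ν (ℤP.<-trans i≪j (i<suc[i] j))

  U-T : ∀ {σ i} j c x → Nil σ → ℤ.suc i ℤ.< j → ∀ p →
        U j c (T i x σ) p ≡ U j c σ p + x * U j c σ (i ∷ p)
  U-T j zero x ν i≪j p = sym (trans (+-identityˡ _) (zeroʳ x))
  U-T {σ} {i} j (suc c) x ν i≪j p = trans
    (cong₂ (λ s t → σ (j ∷ p) + x * s + t) (comm ν [] p i≪j)
      (U-T (ℤ.suc j) c x ν (ℤP.<-trans i≪j (i<suc[i] j)) p))
    (solve 5 (λ x a b c d → a :+ x :* b :+ (c :+ x :* d) := (a :+ c) :+ x :* (b :+ d)) refl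
      x (σ (j ∷ p)) (σ (j ∷ i ∷ p)) (U (ℤ.suc j) c σ p) (U (ℤ.suc j) c σ (i ∷ p)))

  E-T : ∀ {σ i} j c x → Nil σ → ℤ.suc i ℤ.< j → ∀ p →
        E j c (T i x σ) p ≡ E j c σ p + x * E j c σ (i ∷ p)
  E-T j zero x ν i≪j p = sym (trans (+-identityˡ _) (zeroʳ x))
  E-T {σ} {i} j (suc c) x ν i≪j p = trans
    (cong₂ _+_ (U-T j (suc c) x ν i≪j p) (E-T (ℤ.suc j) c x ν (ℤP.<-trans i≪j (i<suc[i] j)) p))
    (solve 5 (λ x a b c d → (a :+ x :* b) :+ (c :+ x :* d) := (a :+ c) :+ x :* (b :+ d)) refl
      x (U j (suc c) σ p) (U j (suc c) σ (i ∷ p)) (E (ℤ.suc j) c σ p) (E (ℤ.suc j) c σ (i ∷ p)))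

  -- The part linear in y of the Fomin-Stanley commutation of A_i(x) with A_i(y). By induction
  -- U_{i+1} commutes with A_{i+1}(x); moreover u_i commutes with A_{i+2}(x), and U_{i+2} with 1 + x
  -- u_i. Only terms in u_i and u_{i+1} remain, and the square and braid relations settle them.
  A-U : ∀ {ρ} i c x → Nil ρ → ∀ p → A i c x (U i c ρ) p ≡ U i c (A i c x ρ) p
  A-U i zero x ν p = refl
  A-U {ρ} i (suc zero) x ν p =
    solve 3 (λ x a b → (a :+ con 0) :+ x :* (b :+ con 0) := (a :+ x :* b) :+ con 0) refl
      x (ρ (i ∷ p)) (ρ (i ∷ i ∷ p))
  A-U {ρ} i (suc (suc c)) x ν p = begin
    B (U i (2 ℕ.+ c) ρ) p + x * B (U i (2 ℕ.+ c) ρ) (i ∷ p)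
      ≡⟨ cong₂ (λ s t → s + x * t) (expand (A-U j (suc c) x ν) p) (expand (A-U j (suc c) x ν) (i ∷ p)) ⟩
    ((τ (i ∷ p) + x * τ (i ∷ j ∷ p)) + (σ (j ∷ p) + V p)) +
    x * ((τ (i ∷ i ∷ p) + x * τ (i ∷ j ∷ i ∷ p)) + (τ (j ∷ i ∷ p) + x * τ (j ∷ j ∷ i ∷ p) + V (i ∷ p)))
      ≡⟨ cong (λ s → ((τ (i ∷ p) + x * τ (i ∷ j ∷ p)) + (σ (j ∷ p) + V p)) + x * s)
           (cong₂ (λ s t → s + (τ (j ∷ i ∷ p) + x * t + V (i ∷ p)))
             (cong₂ (λ s t → s + x * t) (square μ [] i p) (braid μ [] i p))
             (square μ [] j (i ∷ p))) ⟩
    ((τ (i ∷ p) + x * τ (i ∷ j ∷ p)) + (σ (j ∷ p) + V p)) +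
    x * ((0# + x * τ (j ∷ i ∷ j ∷ p)) + (τ (j ∷ i ∷ p) + x * 0# + V (i ∷ p)))
      ≡⟨ solve 8 (λ x a b c d e f g →
           ((a :+ x :* b) :+ (c :+ d)) :+ x :* ((con 0 :+ x :* e) :+ (f :+ x :* con 0 :+ g))
           := ((a :+ x :* f) :+ x :* (con 0 :+ x :* con 0)) :+ ((c :+ x :* (b :+ x :* e)) :+ (d :+ x :* g))) refl
           x (τ (i ∷ p)) (τ (i ∷ j ∷ p)) (σ (j ∷ p)) (V p) (τ (j ∷ i ∷ j ∷ p)) (τ (j ∷ i ∷ p)) (V (i ∷ p)) ⟩
    ((τ (i ∷ p) + x * τ (j ∷ i ∷ p)) + x * (0# + x * 0#)) +
    ((σ (j ∷ p) + x * (τ (i ∷ j ∷ p) + x * τ (j ∷ i ∷ j ∷ p))) + (V p + x * V (i ∷ p)))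
      ≡⟨ cong₂ _+_
           (cong ((τ (i ∷ p) + x * τ (j ∷ i ∷ p)) +_)
             (cong₂ (λ s t → x * (s + x * t)) (sym (square μ [] i p)) (sym (square μ (j ∷ []) i p))))
           (cong ((σ (j ∷ p) + x * σ (i ∷ j ∷ p)) +_)
             (sym (U-T k c x (Nil-A j (suc c) x ν) (i<suc[i] j) p))) ⟩
    T i x σ (i ∷ p) + (T i x σ (j ∷ p) + U k c (T i x σ) p) ∎
    where
    open ≡-Reasoning
    j = ℤ.suc i
    k = ℤ.suc j
    B = A j (suc c) x
    σ = B ρ
    τ = A k c x ρ
    μ = Nil-A k c x ν
    V = U k c σ
    expand : (∀ q → B (U j (suc c) ρ) q ≡ U j (suc c) σ q) →
             ∀ q → B (U i (2 ℕ.+ c) ρ) q ≡ (τ (i ∷ q) + x * τ (i ∷ j ∷ q)) + (σ (j ∷ q) + V q)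
    expand ih q = trans (lin-+ (A-linear j (suc c) x q) (ρ ∘ (i ∷_)) (U j (suc c) ρ))
      (cong₂ _+_ (cong₂ (λ s t → s + x * t) (A-u k c x ν (i<suc[i] j) q) (A-u k c x ν (i<suc[i] j) (j ∷ q)))
                 (ih q))

  module Infinitesimal (ε : K) (ε² : ε * ε ≡ 0#) where

    drop-ε² : ∀ a b → a + ε * (ε * b) ≡ a
    drop-ε² a b = trans (cong (a +_) (trans (sym (*-assoc ε ε b)) (trans (cong (_* b) ε²) (zeroˡ b)))) (+-identityʳ a)

    -- 1 + ε E
    D : ℤ → ℕ → Fn → Fn
    D i c ρ p = ρ p + ε * E i c ρ p

    D-cong : ∀ i c {ρ σ} → (∀ p → ρ p ≡ σ p) → ∀ p → D i c ρ p ≡ D i c σ p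
    D-cong i c h p = cong₂ (λ s t → s + ε * t) (h p) (lin-cong (E-linear i c p) h)

    D-linear : ∀ i c p → Linear (λ ρ → D i c ρ p)
    D-linear i c p = linear-+* ε (linear-at p) (E-linear i c p)

    -- E_i = U_i + E_{i+1}, and the product of the two infinitesimal parts carries the factor ε² =
    -- 0.
    D-U : ∀ i c ρ p → D (ℤ.suc i) c (λ q → ρ q + ε * U i (suc c) ρ q) p ≡ D i (suc c) ρ p
    D-U i c ρ p = begin
      (ρ p + ε * u) + ε * E j c (λ q → ρ q + ε * U i (suc c) ρ q) p
        ≡⟨ cong (λ s → (ρ p + ε * u) + ε * s) (lin-+* (E-linear j c p) ρ ε (U i (suc c) ρ)) ⟩
      (ρ p + ε * u) + ε * (e + ε * e′)
        ≡⟨ solve 5 (λ ε r u e e′ → (r :+ ε :* u) :+ ε :* (e :+ ε :* e′) := (r :+ ε :* (u :+ e)) :+ ε :* (ε :* e′))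
             refl ε (ρ p) u e e′ ⟩
      (ρ p + ε * (u + e)) + ε * (ε * e′) ≡⟨ drop-ε² _ e′ ⟩
      ρ p + ε * (u + e) ∎
      where
      open ≡-Reasoning
      j = ℤ.suc i
      u = U i (suc c) ρ p
      e = E j c ρ p
      e′ = E j c (U i (suc c) ρ) p

    -- A_i(x + ε) (1 + ε E_{i+1}) = (1 + ε E_i) A_i(x); the coefficient of ε is
    -- A_i′ = E_i A_i - A_i E_{i+1}, which telescopes over i.
    A-D : ∀ {ρ} i c x → Nil ρ → ∀ p →
          A i c x (D i c ρ) p ≡ D (ℤ.suc i) (ℕ.pred c) (A i c (x + ε) ρ) p
    A-D i zero x ν p = refl
    A-D {ρ} i (suc c) x ν p = begin
      A i (suc c) x (D i (suc c) ρ) p      ≡⟨ lin-cong (A-linear i (suc c) x p) (λ q → sym (D-U i c ρ q)) ⟩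
      T i x (A j c x (D j c ρ₁)) p         ≡⟨ lin-cong (T-linear i x p) (A-D j c x ν₁) ⟩
      T i x (D k c′ β) p                   ≡⟨ D-T ⟩
      D k c′ (T i x β) p                   ≡⟨ D-cong k c′ Tβ p ⟩
      D k c′ (λ q → α q + ε * U j c α q) p ≡⟨ absorb c ⟩
      D j c α p                            ∎
      where
      open ≡-Reasoning
      j = ℤ.suc i
      k = ℤ.suc j
      c′ = ℕ.pred c
      y = x + ε
      ρ₁ : Fn
      ρ₁ q = ρ q + ε * U i (suc c) ρ q
      ν₁ = Nil-+* ε ν (Nil-U i (suc c) ν)
      σ = A j c y ρ
      α = T i y σ
      β = A j c y ρ₁
      b = A j c y (U i (suc c) ρ)
      D-T : T i x (D k c′ β) p ≡ D k c′ (T i x β) p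
      D-T = trans
        (solve 6 (λ ε x a e a′ e′ → (a :+ ε :* e) :+ x :* (a′ :+ ε :* e′) := (a :+ x :* a′) :+ ε :* (e :+ x :* e′))
          refl ε x (β p) (E k c′ β p) (β (i ∷ p)) (E k c′ β (i ∷ p)))
        (cong (λ s → T i x β p + ε * s) (sym (E-T k c′ x (Nil-A j c y ν₁) (i<suc[i] j) p)))
      AU : ∀ q → b q + y * b (i ∷ q) ≡ σ (i ∷ q) + U j c α q
      AU q = trans (A-U i (suc c) y ν q) (cong (_+ U j c α q)
        (trans (cong (λ s → σ (i ∷ q) + y * s) (square (Nil-A j c y ν) [] i q))
          (trans (cong (σ (i ∷ q) +_) (zeroʳ y)) (+-identityʳ _))))
      -- In the algebra: (1 + ε U_i) A_{i+1}(y) (1 + x u_i) = A_i(y) (1 + ε U_{i+1}). Since x = y -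
      -- ε, the last factor on the left is (1 + y u_i)(1 - ε u_i); U_i passes A_i(y) by `AU`, and
      -- U_i - u_i = U_{i+1}.
      Tβ : ∀ q → T i x β q ≡ α q + ε * U j c α q
      Tβ q = begin
        β q + x * β (i ∷ q)
          ≡⟨ cong₂ (λ s t → s + x * t) (lin-+* (A-linear j c y q) ρ ε _) (lin-+* (A-linear j c y (i ∷ q)) ρ ε _) ⟩
        (σ q + ε * b q) + x * (σ (i ∷ q) + ε * b (i ∷ q))
          ≡⟨ drop-ε² _ (b (i ∷ q)) ⟨
        (σ q + ε * b q) + x * (σ (i ∷ q) + ε * b (i ∷ q)) + ε * (ε * b (i ∷ q))
          ≡⟨ solve 6 (λ ε x s s′ b b′ → (s :+ ε :* b) :+ x :* (s′ :+ ε :* b′) :+ ε :* (ε :* b′)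
               := (s :+ x :* s′) :+ ε :* (b :+ (x :+ ε) :* b′)) refl ε x (σ q) (σ (i ∷ q)) (b q) (b (i ∷ q)) ⟩
        (σ q + x * σ (i ∷ q)) + ε * (b q + y * b (i ∷ q))
          ≡⟨ cong (λ s → (σ q + x * σ (i ∷ q)) + ε * s) (AU q) ⟩
        (σ q + x * σ (i ∷ q)) + ε * (σ (i ∷ q) + U j c α q)
          ≡⟨ solve 5 (λ ε x s s′ u → (s :+ x :* s′) :+ ε :* (s′ :+ u) := (s :+ (x :+ ε) :* s′) :+ ε :* u)
               refl ε x (σ q) (σ (i ∷ q)) (U j c α q) ⟩
        α q + ε * U j c α q ∎
      -- For `c` = 0 the predecessor is again 0, and the sums in `U` and `E` are empty.
      absorb : ∀ c → D k (ℕ.pred c) (λ q → α q + ε * U j c α q) p ≡ D j c α p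
      absorb zero = trans (cong (α p + ε * 0# +_) (zeroʳ ε)) (+-identityʳ _)
      absorb (suc c) = D-U j c α p

    -- Behind the last factor the sum E is empty, so 1 + ε E may be inserted there. Moving it to the
    -- front by `A-D` absorbs the ε of each factor that it passes.
    P-D : ∀ {n ρ} i (xs : Vec K n) → Nil ρ → P i (Vec.map (_+ ε) xs) ρ ≡ P i xs (D i n ρ)
    P-D {ρ = ρ} i [] ν = sym (trans (cong (ρ [] +_) (zeroʳ ε)) (+-identityʳ _))
    P-D {suc n} {ρ} i (x ∷ xs) ν = trans
      (P-D (ℤ.suc i) xs (Nil-A i (suc n) (x + ε) ν))
      (lin-cong (P-linear (ℤ.suc i) xs) (λ p → sym (A-D i (suc n) x ν p)))

-- Reduced words

i+1≡suc[i] : ∀ i → i ℤ.+ ℤ.1ℤ ≡ ℤ.suc i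
i+1≡suc[i] i = ℤP.+-comm i ℤ.1ℤ

s-self : ∀ i → sᵢ i i ≡ ℤ.suc i
s-self i rewrite dec-true (i ℤP.≟ i) refl = i+1≡suc[i] i

s-next : ∀ i → sᵢ i (ℤ.suc i) ≡ i
s-next i rewrite dec-false (ℤ.suc i ℤP.≟ i) (≢-sym (ℤP.<⇒≢ (i<suc[i] i)))
  | dec-true (ℤ.suc i ℤP.≟ (i ℤ.+ ℤ.1ℤ)) (sym (i+1≡suc[i] i)) = refl

s-other : ∀ i {x} → x ≢ i → x ≢ ℤ.suc i → sᵢ i x ≡ x
s-other i {x} x≢i x≢1+i rewrite dec-false (x ℤP.≟ i) x≢i
  | dec-false (x ℤP.≟ (i ℤ.+ ℤ.1ℤ)) (λ e → x≢1+i (trans e (i+1≡suc[i] i))) = refl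

data Position (i x : ℤ) : Set where
  self  : x ≡ i → Position i x
  next  : x ≡ ℤ.suc i → Position i x
  other : x ≢ i → x ≢ ℤ.suc i → Position i x

position : ∀ i x → Position i x
position i x with x ℤP.≟ i | x ℤP.≟ ℤ.suc i
... | yes e | _     = self e
... | no _  | yes e = next e
... | no n  | no m  = other n m

s-square : ∀ i x → sᵢ i (sᵢ i x) ≡ x
s-square i x with position i x
... | self refl = trans (cong (sᵢ i) (s-self i)) (s-next i)
... | next refl = trans (cong (sᵢ i) (s-next i)) (s-self i)
... | other n m = trans (cong (sᵢ i) (s-other i n m)) (s-other i n m)

s-comm : ∀ {i j} → ℤ.suc i ℤ.< j → ∀ x → sᵢ i (sᵢ j x) ≡ sᵢ j (sᵢ i x)
s-comm {i} {j} i≪j x with position i x | position j x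
... | self refl | _ = trans (cong (sᵢ i) (fix i<j)) (trans (s-self i) (sym (trans (cong (sᵢ j) (s-self i)) (fix i≪j))))
  where
  i<j = ℤP.<-trans (i<suc[i] i) i≪j
  fix : ∀ {y} → y ℤ.< j → sᵢ j y ≡ y
  fix y<j = s-other j (ℤP.<⇒≢ y<j) (ℤP.<⇒≢ (ℤP.<-trans y<j (i<suc[i] j)))
... | next refl | _ = trans (cong (sᵢ i) (fix i≪j)) (trans (s-next i) (sym (trans (cong (sᵢ j) (s-next i)) (fix i<j))))
  where
  i<j = ℤP.<-trans (i<suc[i] i) i≪j
  fix : ∀ {y} → y ℤ.< j → sᵢ j y ≡ y
  fix y<j = s-other j (ℤP.<⇒≢ y<j) (ℤP.<⇒≢ (ℤP.<-trans y<j (i<suc[i] j)))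
... | other n m | other n′ m′ = trans (cong (sᵢ i) (s-other j n′ m′)) (trans (s-other i n m)
        (sym (trans (cong (sᵢ j) (s-other i n m)) (s-other j n′ m′))))
... | other n m | self refl = trans (cong (sᵢ i) (s-self j)) (trans (fix (ℤP.<-trans i≪j (i<suc[i] j)))
        (sym (trans (cong (sᵢ j) (s-other i n m)) (s-self j))))
  where
  fix : ∀ {y} → ℤ.suc i ℤ.< y → sᵢ i y ≡ y
  fix h = s-other i (≢-sym (ℤP.<⇒≢ (ℤP.<-trans (i<suc[i] i) h))) (≢-sym (ℤP.<⇒≢ h))
... | other n m | next refl = trans (cong (sᵢ i) (s-next j)) (trans (fix i≪j)
        (sym (trans (cong (sᵢ j) (s-other i n m)) (s-next j))))
  where
  fix : ∀ {y} → ℤ.suc i ℤ.< y → sᵢ i y ≡ y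
  fix h = s-other i (≢-sym (ℤP.<⇒≢ (ℤP.<-trans (i<suc[i] i) h))) (≢-sym (ℤP.<⇒≢ h))

s-braid : ∀ i x → sᵢ i (sᵢ (ℤ.suc i) (sᵢ i x)) ≡ sᵢ (ℤ.suc i) (sᵢ i (sᵢ (ℤ.suc i) x))
s-braid i x with position i x | position (ℤ.suc i) x
... | self refl | _ = trans (cong (sᵢ i ∘ sᵢ j) (s-self i)) (trans (cong (sᵢ i) (s-self j)) (trans fix-k
        (sym (trans (cong (sᵢ j ∘ sᵢ i) fix-i) (trans (cong (sᵢ j) (s-self i)) (s-self j))))))
  where
  j = ℤ.suc i
  i<j = i<suc[i] i
  j<k = i<suc[i] j
  fix-i = s-other j (ℤP.<⇒≢ i<j) (ℤP.<⇒≢ (ℤP.<-trans i<j j<k))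
  fix-k = s-other i (≢-sym (ℤP.<⇒≢ (ℤP.<-trans i<j j<k))) (≢-sym (ℤP.<⇒≢ j<k))
... | next refl | _ = trans (cong (sᵢ i ∘ sᵢ j) (s-next i)) (trans (cong (sᵢ i) fix-i) (trans (s-self i)
        (sym (trans (cong (sᵢ j ∘ sᵢ i) (s-self j)) (trans (cong (sᵢ j) fix-k) (s-next j))))))
  where
  j = ℤ.suc i
  i<j = i<suc[i] i
  j<k = i<suc[i] j
  fix-i = s-other j (ℤP.<⇒≢ i<j) (ℤP.<⇒≢ (ℤP.<-trans i<j j<k))
  fix-k = s-other i (≢-sym (ℤP.<⇒≢ (ℤP.<-trans i<j j<k))) (≢-sym (ℤP.<⇒≢ j<k))
... | other n m | self e = ⊥-elim (m e)
... | other n m | next refl = trans (cong (sᵢ i ∘ sᵢ j) (s-other i n m)) (trans (cong (sᵢ i) (s-next j)) (trans (s-next i)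
        (sym (trans (cong (sᵢ j ∘ sᵢ i) (s-next j)) (trans (cong (sᵢ j) (s-next i)) fix-i)))))
  where
  j = ℤ.suc i
  fix-i = s-other j (ℤP.<⇒≢ (i<suc[i] i)) (ℤP.<⇒≢ (ℤP.<-trans (i<suc[i] i) (i<suc[i] j)))
... | other n m | other n′ m′ =
        trans (cong (sᵢ i ∘ sᵢ j) (s-other i n m)) (trans (cong (sᵢ i) (s-other j n′ m′)) (trans (s-other i n m)
          (sym (trans (cong (sᵢ j ∘ sᵢ i) (s-other j n′ m′)) (trans (cong (sᵢ j) (s-other i n m)) (s-other j n′ m′))))))
  where j = ℤ.suc i

act-++ : ∀ p q x → act (p ++ q) x ≡ act p (act q x)
act-++ [] q x = refl
act-++ (i ∷ p) q x = cong (sᵢ i) (act-++ p q x)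

act-prefix : ∀ p {q q′} → (∀ x → act q x ≡ act q′ x) → ∀ x → act (p ++ q) x ≡ act (p ++ q′) x
act-prefix p {q} {q′} h x = trans (act-++ p q x) (trans (cong (act p) (h x)) (sym (act-++ p q′ x)))

map-val-emb : ∀ q → map val (emb q) ≡ q
map-val-emb [] = refl
map-val-emb (i ∷ q) = cong (i ∷_) (map-val-emb q)

emb-uncoloured : ∀ q → All (λ l → proj₂ l ≡ 0) (emb q)
emb-uncoloured [] = []
emb-uncoloured (i ∷ q) = refl ∷ emb-uncoloured q

module Sch {w : PermZ} {s : 𝒬} (sch : IsSch w s) where

  reduced-transfer : ∀ {q q′} → (∀ x → act q x ≡ act q′ x) → length q ≡ length q′ →
                     IsReduced w (emb q) → IsReduced w (emb q′)
  reduced-transfer {q} {q′} h l (_ , f , min) = emb-uncoloured q′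
    , (λ x → trans (cong (λ r → act r x) (map-val-emb q′)) (trans (sym (h x))
        (trans (cong (λ r → act r x) (sym (map-val-emb q))) (f x))))
    , λ v g → subst (ℕ._≤ length v) (trans (LP.length-map _ q) (trans l (sym (LP.length-map _ q′)))) (min v g)

  -- `IsReduced` quantifies over all words and is not decided here. Equality of rationals is
  -- decidable, so it is enough to refute a difference: then neither word could be reduced, and both
  -- coefficients would be 0.
  coeff-transfer : ∀ {q q′} → (∀ x → act q x ≡ act q′ x) → length q ≡ length q′ →
                   coeff s (emb q) ≡ coeff s (emb q′)
  coeff-transfer {q} {q′} h l = decidable-stable (coeff s (emb q) ℚP.≟ coeff s (emb q′)) λ n →
    let ¬red = λ r → n (trans (proj₁ (sch (emb q)) r)
                   (sym (proj₁ (sch (emb q′)) (reduced-transfer h l r))))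
    in n (trans (proj₂ (sch (emb q)) ¬red)
           (sym (proj₂ (sch (emb q′)) (¬red ∘ reduced-transfer (sym ∘ h) (sym l)))))

  coeff-square : ∀ p i q → coeff s (emb (p ++ i ∷ i ∷ q)) ≡ 0ℚ
  coeff-square p i q = proj₂ (sch _) λ { (_ , f , min) → ℕP.<⇒≱ shorter (min (p ++ q) λ x →
      trans (sym (act-prefix p {i ∷ i ∷ q} {q} (λ y → s-square i (act q y)) x))
        (trans (cong (λ r → act r x) (sym (map-val-emb (p ++ i ∷ i ∷ q)))) (f x))) }
    where
    shorter : length (p ++ q) ℕ.< length (emb (p ++ i ∷ i ∷ q))
    shorter rewrite LP.length-map (_, 0) (p ++ i ∷ i ∷ q) | LP.length-++ p {q} | LP.length-++ p {i ∷ i ∷ q} =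
      ℕP.+-monoʳ-< (length p) (ℕP.m≤n⇒m≤1+n ℕP.≤-refl)

  length-prefix : ∀ (p : List ℤ) {q q′} → length q ≡ length q′ → length (p ++ q) ≡ length (p ++ q′)
  length-prefix p {q} {q′} l = trans (LP.length-++ p) (trans (cong (length p ℕ.+_) l) (sym (LP.length-++ p)))

  coeff-comm : ∀ p {i j} q → ℤ.suc i ℤ.< j → coeff s (emb (p ++ i ∷ j ∷ q)) ≡ coeff s (emb (p ++ j ∷ i ∷ q))
  coeff-comm p {i} {j} q i≪j = coeff-transfer
    (act-prefix p {i ∷ j ∷ q} {j ∷ i ∷ q} (λ x → s-comm i≪j (act q x)))
    (length-prefix p {i ∷ j ∷ q} {j ∷ i ∷ q} refl)

  coeff-braid : ∀ p i q → coeff s (emb (p ++ i ∷ ℤ.suc i ∷ i ∷ q)) ≡ coeff s (emb (p ++ ℤ.suc i ∷ i ∷ ℤ.suc i ∷ q))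
  coeff-braid p i q = coeff-transfer
    (act-prefix p {i ∷ ℤ.suc i ∷ i ∷ q} {ℤ.suc i ∷ i ∷ ℤ.suc i ∷ q} (λ x → s-braid i (act q x)))
    (length-prefix p {i ∷ ℤ.suc i ∷ i ∷ q} {ℤ.suc i ∷ i ∷ ℤ.suc i ∷ q} refl)

-- Slide polynomials as nilCoxeter products

NotHead : ℤ → List ℤ → Set
NotHead z [] = ⊤
NotHead z (y ∷ q) = z ≢ y

-- The words on which slide polynomials match nilCoxeter products: runs in a slide polynomial may
-- repeat a letter, whereas `A` contains each generator once. Words with equal neighbours are not
-- reduced and have coefficient 0 in Sch(w).
data Good (h : ℤ) : List ℤ → Set where
  []   : Good h []
  cons : ∀ {z q} → z ℤ.< h → NotHead z q → Good h q → Good h (z ∷ q)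

good-or-square : ∀ {h} q → All (ℤ._< h) q →
                 Good h q ⊎ (∃ λ p → ∃ λ i → ∃ λ r → q ≡ p ++ i ∷ i ∷ r)
good-or-square [] [] = inj₁ []
good-or-square (z ∷ q) (z<h ∷ hs) with good-or-square q hs
... | inj₂ (p , i , r , refl) = inj₂ (z ∷ p , i , r , refl)
good-or-square (z ∷ []) (z<h ∷ hs) | inj₁ g = inj₁ (cons z<h tt g)
good-or-square (z ∷ y ∷ q) (z<h ∷ hs) | inj₁ g with z ℤP.≟ y
... | yes refl = inj₂ ([] , z , q , refl)
... | no z≢y = inj₁ (cons z<h z≢y g)

uncoloured⇒emb : ∀ u → All (λ l → proj₂ l ≡ 0) u → u ≡ emb (map val u)
uncoloured⇒emb [] [] = refl
uncoloured⇒emb ((v , .0) ∷ u) (refl ∷ hs) = cong ((v , 0) ∷_) (uncoloured⇒emb u hs)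

i+suc[c] : ∀ i c → i ℤ.+ (ℤ.+ suc c) ≡ ℤ.suc i ℤ.+ (ℤ.+ c)
i+suc[c] i c = trans (sym (ℤP.+-assoc i ℤ.1ℤ (ℤ.+ c))) (cong (ℤ._+ (ℤ.+ c)) (ℤP.+-comm i ℤ.1ℤ))

/1-suc : ∀ i → ℤ.suc i ℚ./ 1 ≡ 1ℚ ℚ.+ (i ℚ./ 1)
/1-suc i = ℚP.toℚᵘ-injective (begin-equality
    ℚ.toℚᵘ (ℤ.suc i ℚ./ 1)                    ≃⟨ ℚP.toℚᵘ-fromℚᵘ (ℚᵘ.mkℚᵘ (ℤ.suc i) 0) ⟩
    ℚᵘ.mkℚᵘ (ℤ.suc i) 0                       ≃⟨ ℚᵘ.*≡* eq ⟩
    ℚ.toℚᵘ 1ℚ ℚᵘ.+ ℚᵘ.mkℚᵘ i 0                ≃⟨ ℚᵘP.+-congʳ (ℚ.toℚᵘ 1ℚ) (ℚᵘP.≃-sym (ℚP.toℚᵘ-fromℚᵘ (ℚᵘ.mkℚᵘ i 0))) ⟩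
    ℚ.toℚᵘ 1ℚ ℚᵘ.+ ℚ.toℚᵘ (i ℚ./ 1)           ≃⟨ ℚᵘP.≃-sym (ℚP.toℚᵘ-homo-+ 1ℚ (i ℚ./ 1)) ⟩
    ℚ.toℚᵘ (1ℚ ℚ.+ (i ℚ./ 1))                 ∎)
  where
  open ℚᵘP.≤-Reasoning
  eq : ℤ.suc i ℤ.* ℤ.1ℤ ≡ (ℤ.1ℤ ℤ.* ℤ.1ℤ ℤ.+ i ℤ.* ℤ.1ℤ) ℤ.* ℤ.1ℤ
  eq = cong (ℤ._* ℤ.1ℤ) (cong ℤ.suc (sym (ℤP.*-identityʳ i)))

-- The coefficient z - i + 1 of u_z in E_i. The bracketing separates the value, which `∇` uses, from
-- a constant, which multiplies `ξ`.
weight : ℤ → ℤ → ℚ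
weight i z = (z ℚ./ 1) ℚ.+ (1ℚ ℚ.- (i ℚ./ 1))

weight-self : ∀ i → weight i i ≡ 1ℚ
weight-self i = begin
  r ℚ.+ (1ℚ ℚ.- r)   ≡⟨ cong (r ℚ.+_) (ℚP.+-comm 1ℚ (ℚ.- r)) ⟩
  r ℚ.+ (ℚ.- r ℚ.+ 1ℚ) ≡⟨ ℚP.+-assoc r (ℚ.- r) 1ℚ ⟨
  (r ℚ.- r) ℚ.+ 1ℚ   ≡⟨ cong (ℚ._+ 1ℚ) (ℚP.+-inverseʳ r) ⟩
  0ℚ ℚ.+ 1ℚ          ≡⟨⟩
  1ℚ                 ∎
  where
  open ≡-Reasoning
  r = i ℚ./ 1

weight-suc : ∀ i z → weight i z ≡ 1ℚ ℚ.+ weight (ℤ.suc i) z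
weight-suc i z = begin
  s ℚ.+ (1ℚ ℚ.- r)                    ≡⟨ solve 3 (λ s r o → s :+ (o :- r) := o :+ (s :+ (o :- (o :+ r)))) refl s r 1ℚ ⟩
  1ℚ ℚ.+ (s ℚ.+ (1ℚ ℚ.- (1ℚ ℚ.+ r)))  ≡⟨ cong (λ k → 1ℚ ℚ.+ (s ℚ.+ (1ℚ ℚ.- k))) (/1-suc i) ⟨
  1ℚ ℚ.+ weight (ℤ.suc i) z           ∎
  where
  open ≡-Reasoning
  open import Data.Rational.Solver using (module +-*-Solver)
  open +-*-Solver
  r = i ℚ./ 1
  s = z ℚ./ 1

module Pairing (S : Scalars) where
  open Scalars S
  open Evaluation S
  open Slides S
  open NilCoxeter S
  open Linear

  δ : Word → Fn
  δ u p = if does (u ≟W emb p) then 1# else 0#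

  δ-∷ : ∀ z u i p → δ (z ∷ u) (i ∷ p) ≡ (if does (z ≟L (i , 0)) then δ u p else 0#)
  δ-∷ z u i p with does (z ≟L (i , 0))
  ... | true  = refl
  ... | false = refl

  δ-hit : ∀ u i p → δ ((i , 0) ∷ u) (i ∷ p) ≡ δ u p
  δ-hit u i p = trans (δ-∷ (i , 0) u i p)
    (cong (λ d → if d then δ u p else 0#) (dec-true ((i , 0) ≟L (i , 0)) refl))

  δ-miss : ∀ {z i} u p → z ≢ i → δ ((z , 0) ∷ u) (i ∷ p) ≡ 0#
  δ-miss {z} {i} u p z≢i = trans (δ-∷ (z , 0) u i p)
    (cong (λ d → if d then δ u p else 0#) (dec-false ((z , 0) ≟L (i , 0)) (z≢i ∘ cong proj₁)))

  -- The coefficient function of `s` is the combination of the `δ u` with the coefficients of `s`.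
  -- This passes from a sum over words to a single function, to which the nilCoxeter relations can
  -- apply even if no `δ u` satisfies them.
  eval-δ : ∀ {Q} → Linear Q → ∀ s → eval (λ u → Q (δ u)) s ≡ Q (λ p → ι (coeff s (emb p)))
  eval-δ {Q} l [] = sym (trans (lin-cong l (λ _ → ι-0)) (lin-0 l))
  eval-δ {Q} l ((c , u) ∷ s) = begin
    ι c * Q (δ u) + eval (λ u → Q (δ u)) s       ≡⟨ cong (ι c * Q (δ u) +_) (eval-δ l s) ⟩
    ι c * Q (δ u) + Q ρ                          ≡⟨ +-comm _ _ ⟩
    Q ρ + ι c * Q (δ u)                          ≡⟨ lin-+* l ρ (ι c) (δ u) ⟨
    Q (λ p → ρ p + ι c * δ u p)                  ≡⟨ lin-cong l (λ p → trans (+-comm _ _)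
                                                      (trans (cong (_+ ρ p) (term (does (u ≟W emb p)))) (sym (ι-+ _ _)))) ⟩
    Q (λ p → ι (coeff ((c , u) ∷ s) (emb p)))    ∎
    where
    open ≡-Reasoning
    ρ : Fn
    ρ p = ι (coeff s (emb p))
    term : ∀ d → ι c * (if d then 1# else 0#) ≡ ι (if d then c else 0ℚ)
    term true  = *-identityʳ _
    term false = trans (zeroʳ _) (sym ι-0)

  -- The transpose of 1 + x u_i, on functions of words.
  T* : ℤ → K → (Word → K) → Word → K
  T* i x g [] = g []
  T* i x g (z ∷ u) = g (z ∷ u) + (if does (z ≟L (i , 0)) then x * g u else 0#)

  T*-δ : ∀ {Q} → Linear Q → ∀ i x u → Q (T i x (δ u)) ≡ T* i x (λ u → Q (δ u)) u
  T*-δ {Q} l i x [] = lin-cong l (λ p → trans (cong (δ [] p +_) (zeroʳ x)) (+-identityʳ _))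
  T*-δ {Q} l i x (z ∷ u) = trans (lin-+* l (δ (z ∷ u)) x (λ p → δ (z ∷ u) (i ∷ p)))
      (cong (Q (δ (z ∷ u)) +_) (trans (cong (x *_) (lin-cong l (δ-∷ z u i))) (pull (does (z ≟L (i , 0))))))
    where
    pull : ∀ d → x * Q (λ p → if d then δ u p else 0#) ≡ (if d then x * Q (δ u) else 0#)
    pull true  = refl
    pull false = trans (cong (x *_) (lin-0 l)) (zeroʳ x)

  W-ext : ∀ L x {g g′} → (∀ u → g u ≡ g′ u) → ∀ b u → W L x g b u ≡ W L x g′ b u
  W-ext L x h b [] = h []
  W-ext L x h b (z ∷ u) = cong₂ _+_ (h (z ∷ u))
    (cong (λ s → if ok L b z then x * s else 0#) (W-ext L x h (just z) u))

  W-good : ∀ L x {h g g′} → (∀ {q} → Good h q → g (emb q) ≡ g′ (emb q)) →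
           ∀ b {q} → Good h q → W L x g b (emb q) ≡ W L x g′ b (emb q)
  W-good L x e b [] = e []
  W-good L x e b {z ∷ q} γ@(cons _ _ γ′) = cong₂ _+_ (e γ)
    (cong (λ s → if ok L b (z , 0) then x * s else 0#) (W-good L x e (just (z , 0)) γ′))

  W-below : ∀ {L} x g b {q} → Good L q → W L x g b (emb q) ≡ g (emb q)
  W-below x g b [] = refl
  W-below {L} x g b {z ∷ q} (cons z<L _ _) rewrite dec-false (L ℤP.≤? z) (ℤP.<⇒≱ z<L) = +-identityʳ _

  W-stop : ∀ i x g {q} → NotHead i q → W i x g (just (i , 0)) (emb q) ≡ g (emb q)
  W-stop i x g {[]} _ = refl
  W-stop i x g {y ∷ q} i≢y with ℤP.<-cmp i y
  ... | tri< i<y _ _ = W-cut i x g {y , 0} {i , 0} (emb q) (inj₁ i<y)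
  ... | tri≈ _ i≡y _ = ⊥-elim (i≢y i≡y)
  ... | tri> _ _ y<i rewrite dec-false (i ℤP.≤? y) (ℤP.<⇒≱ y<i) = +-identityʳ _

  -- Without equal neighbours, a decreasing run with letters ≥ i meets i at most once, as its last
  -- letter. So it is a run with letters > i followed optionally by i, and `T*` accounts for this
  -- last step.
  W-peel : ∀ {h} i x g b {q} → allowed b (i , 0) ≡ true → Good h q →
           W i x g b (emb q) ≡ W (ℤ.suc i) x (T* i x g) b (emb q)
  W-peel i x g b bi [] = refl
  W-peel i x g b {z ∷ q} bi (cons _ nh γ) with ℤP.<-cmp z i
  ... | tri< z<i z≢i _
        rewrite dec-false (i ℤP.≤? z) (ℤP.<⇒≱ z<i)
              | dec-false (ℤ.suc i ℤP.≤? z) (ℤP.<⇒≱ (ℤP.<-trans z<i (i<suc[i] i)))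
              | dec-false ((z , 0) ≟L (i , 0)) (z≢i ∘ cong proj₁) =
        sym (+-identityʳ _)
  ... | tri≈ _ refl _
        rewrite dec-true (z ℤP.≤? z) ℤP.≤-refl
              | dec-false (ℤ.suc z ℤP.≤? z) (ℤP.<⇒≱ (i<suc[i] z))
              | dec-true ((z , 0) ≟L (z , 0)) refl | bi =
        trans (cong (λ s → g (emb (z ∷ q)) + x * s) (W-stop z x g nh)) (sym (+-identityʳ _))
  ... | tri> _ z≢i i<z
        rewrite dec-true (i ℤP.≤? z) (ℤP.<⇒≤ i<z)
              | dec-true (ℤ.suc i ℤP.≤? z) (ℤP.i<j⇒suc[i]≤j i<z)
              | dec-false ((z , 0) ≟L (i , 0)) (z≢i ∘ cong proj₁) =
        cong₂ _+_ (sym (+-identityʳ _)) (cong (λ s → if allowed b (z , 0) then x * s else 0#)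
          (W-peel i x g (just (z , 0))
            (cong not (⊀⇒≮L (z , 0) (i , 0) λ { (inj₁ z<i) → ℤP.<-asym i<z z<i ; (inj₂ (e , _)) → z≢i e })) γ))

  -- Expanding `A` gives one term for each strictly decreasing word in the window, and on good words
  -- these are the runs that `W` sums over. The induction peels off the lowest generator and absorbs
  -- its factor into `Q`, which is therefore arbitrary.
  A-δ : ∀ {h Q} → Linear Q → ∀ i c x {q} → i ℤ.+ (ℤ.+ c) ≡ h → Good h q →
        Q (A i c x (δ (emb q))) ≡ W i x (λ u → Q (δ u)) nothing (emb q)
  A-δ {Q = Q} l i zero x refl γ =
    sym (W-below x (λ u → Q (δ u)) nothing (subst (λ h → Good h _) (ℤP.+-identityʳ i) γ))
  A-δ {Q = Q} l i (suc c) x {q} refl γ = begin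
    Q (T i x (A (ℤ.suc i) c x (δ (emb q))))
      ≡⟨ A-δ (linear-∘ l (T-linear i x)) (ℤ.suc i) c x (sym (i+suc[c] i c)) γ ⟩
    W (ℤ.suc i) x (λ u → Q (T i x (δ u))) nothing (emb q)
      ≡⟨ W-ext (ℤ.suc i) x (T*-δ l i x) nothing (emb q) ⟩
    W (ℤ.suc i) x (T* i x (λ u → Q (δ u))) nothing (emb q)
      ≡⟨ W-peel i x (λ u → Q (δ u)) nothing refl γ ⟨
    W i x (λ u → Q (δ u)) nothing (emb q) ∎
    where open ≡-Reasoning

  F≡P : ∀ {n h} i (xs : Vec K n) {q} → i ℤ.+ (ℤ.+ n) ≡ h → Good h q → F i xs (emb q) ≡ P i xs (δ (emb q))
  F≡P i [] _ [] = refl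
  F≡P i [] _ (cons _ _ _) = refl
  F≡P {suc n} i (x ∷ xs) {q} eq γ = sym (trans
    (A-δ (P-linear (ℤ.suc i) xs) i (suc n) x eq γ)
    (W-good i x (λ γ′ → sym (F≡P (ℤ.suc i) xs (trans (sym (i+suc[c] i n)) eq) γ′)) nothing γ))

  U-δ-below : ∀ {z} i c u p → z ℤ.< i → U i c (δ ((z , 0) ∷ u)) p ≡ 0#
  U-δ-below i zero u p z<i = refl
  U-δ-below {z} i (suc c) u p z<i = trans
    (cong₂ _+_ (δ-miss u p (ℤP.<⇒≢ z<i)) (U-δ-below (ℤ.suc i) c u p (ℤP.<-trans z<i (i<suc[i] i))))
    (+-identityˡ _)

  E-δ-below : ∀ {z} i c u p → z ℤ.< i → E i c (δ ((z , 0) ∷ u)) p ≡ 0#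
  E-δ-below i zero u p z<i = refl
  E-δ-below {z} i (suc c) u p z<i = trans
    (cong₂ _+_ (U-δ-below i (suc c) u p z<i) (E-δ-below (ℤ.suc i) c u p (ℤP.<-trans z<i (i<suc[i] i))))
    (+-identityˡ _)

  U-δ : ∀ {z} i c u p → i ℤ.≤ z → z ℤ.< i ℤ.+ (ℤ.+ c) → U i c (δ ((z , 0) ∷ u)) p ≡ δ u p
  U-δ i zero u p i≤z z<i = ⊥-elim (ℤP.<⇒≱ (subst (_ ℤ.<_) (ℤP.+-identityʳ i) z<i) i≤z)
  U-δ {z} i (suc c) u p i≤z z< with ℤP.<-cmp z i
  ... | tri< z<i _ _ = ⊥-elim (ℤP.<⇒≱ z<i i≤z)
  ... | tri≈ _ refl _ = trans (cong₂ _+_ (δ-hit u i p) (U-δ-below (ℤ.suc i) c u p (i<suc[i] i))) (+-identityʳ _)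
  ... | tri> _ z≢i i<z = trans (cong₂ _+_ (δ-miss u p z≢i)
        (U-δ (ℤ.suc i) c u p (ℤP.i<j⇒suc[i]≤j i<z) (subst (z ℤ.<_) (i+suc[c] i c) z<)))
        (+-identityˡ _)

  -- E_i is the sum of U_i, U_{i+1}, ...; the generator u_z occurs once in each of U_i, ..., U_z and
  -- in no later one, hence z - i + 1 times.
  E-δ : ∀ {z} i c u p → i ℤ.≤ z → z ℤ.< i ℤ.+ (ℤ.+ c) →
        E i c (δ ((z , 0) ∷ u)) p ≡ ι (weight i z) * δ u p
  E-δ i zero u p i≤z z<i = ⊥-elim (ℤP.<⇒≱ (subst (_ ℤ.<_) (ℤP.+-identityʳ i) z<i) i≤z)
  E-δ {z} i (suc c) u p i≤z z< = trans (cong₂ _+_ (U-δ i (suc c) u p i≤z z<) refl) (rest (ℤP.<-cmp z i))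
    where
    rest : _ → δ u p + E (ℤ.suc i) c (δ ((z , 0) ∷ u)) p ≡ ι (weight i z) * δ u p
    rest (tri< z<i _ _) = ⊥-elim (ℤP.<⇒≱ z<i i≤z)
    rest (tri≈ _ refl _) = trans (cong (δ u p +_) (E-δ-below (ℤ.suc i) c u p (i<suc[i] i)))
      (trans (+-identityʳ _) (sym (trans (cong (λ k → ι k * δ u p) (weight-self i))
        (trans (cong (_* δ u p) ι-1) (*-identityˡ _)))))
    rest (tri> _ _ i<z) = trans
      (cong₂ _+_ (sym (trans (cong (_* δ u p) ι-1) (*-identityˡ _)))
        (E-δ (ℤ.suc i) c u p (ℤP.i<j⇒suc[i]≤j i<z) (subst (z ℤ.<_) (i+suc[c] i c) z<)))
      (trans (sym (distribʳ _ _ _)) (cong (_* δ u p)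
        (trans (sym (ι-+ 1ℚ (weight (ℤ.suc i) z))) (cong ι (sym (weight-suc i z))))))

  E-δ-[] : ∀ i c p → E i c (δ []) p ≡ 0#
  E-δ-[] i zero p = refl
  E-δ-[] i (suc c) p = trans (cong₂ _+_ (u i (suc c)) (E-δ-[] (ℤ.suc i) c p)) (+-identityˡ _)
    where
    u : ∀ i c → U i c (δ []) p ≡ 0#
    u i zero = refl
    u i (suc c) = trans (+-identityˡ _) (u (ℤ.suc i) c)

-- Bounded windows, and the agreement of the two characters on ℛ

IsBounded : ℕ → Word → Set
IsBounded N = All (λ z → ∣ val z ∣ ℕ.< N)

bound-word : ∀ u → ∃ λ N → IsBounded N u
bound-word [] = 0 , []
bound-word (z ∷ u) with bound-word u
... | N , h = suc ∣ val z ∣ ℕ.⊔ N , ℕP.m≤m⊔n _ N ∷ All.map (λ l → ℕP.≤-trans l (ℕP.m≤n⊔m _ N)) h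

bounded-mono : ∀ {M N} → M ℕ.≤ N → ∀ {u} → IsBounded M u → IsBounded N u
bounded-mono M≤N = All.map (λ l → ℕP.≤-trans l M≤N)

bound-𝒬 : ∀ a → ∃ λ N → Keys (IsBounded N) a
bound-𝒬 [] = 0 , []
bound-𝒬 ((c , u) ∷ a) with bound-word u | bound-𝒬 a
... | M , h | N , hs = M ℕ.⊔ N , bounded-mono (ℕP.m≤m⊔n M N) h ∷ All.map (bounded-mono (ℕP.m≤n⊔m M N)) hs

∣z∣<N⇒z<N : ∀ z {N} → ∣ z ∣ ℕ.< N → z ℤ.< ℤ.+ N
∣z∣<N⇒z<N (ℤ.+ n) h = ℤ.+<+ h
∣z∣<N⇒z<N ℤ.-[1+ n ] h = ℤ.-<+

∣z∣<N⇒-N≤z : ∀ z {N} → ∣ z ∣ ℕ.< N → ℤ.- (ℤ.+ N) ℤ.≤ z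
∣z∣<N⇒-N≤z (ℤ.+ n) h = ℤP.neg-≤-pos
∣z∣<N⇒-N≤z ℤ.-[1+ n ] h = ℤP.neg-mono-≤ (ℤ.+≤+ (ℕP.<⇒≤ h))

-N+[N+N] : ∀ N → ℤ.- (ℤ.+ N) ℤ.+ (ℤ.+ (N ℕ.+ N)) ≡ ℤ.+ N
-N+[N+N] N = trans (cong (λ k → ℤ.- (ℤ.+ N) ℤ.+ k) (ℤP.pos-+ N N))
  (trans (sym (ℤP.+-assoc (ℤ.- (ℤ.+ N)) (ℤ.+ N) (ℤ.+ N)))
    (trans (cong (ℤ._+ (ℤ.+ N)) (ℤP.+-inverseˡ (ℤ.+ N))) (ℤP.+-identityˡ (ℤ.+ N))))

module Derivation (S : Scalars) (ε : Scalars.K S) (ε² : Scalars._*_ S ε ε ≡ Scalars.0# S) where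
  open Scalars S
  open Evaluation S
  open Slides S
  open NilCoxeter S
  open Linear
  open Infinitesimal ε ε²
  open Pairing S
  open import Algebra.Solver.Ring.NaturalCoefficients.Default commutativeSemiring
    using (solve; _:=_; _:+_; _:*_; con)

  module _ {n : ℕ} (i : ℤ) (xs : Vec K n) where

    ∂ : Word → K
    ∂ [] = 0#
    ∂ (z ∷ u) = ι (weight i (val z)) * F i xs u

    translated : Word → K
    translated = F i (Vec.map (_+ ε) xs)

    perturbed : Word → K
    perturbed u = F i xs u + ε * ∂ u

    private
      module χ = Character (F-character i xs)

    -- The Leibniz rule: an interlacing starts with the first letter of `p` or of `q`, which fixes
    -- the weight, and continues with an interlacing of what is left, on which `F` is
    -- multiplicative.
    ∂-shuffle : ∀ p q → Disjoint p q → Σw ∂ (shuffle p q) ≡ ∂ p * F i xs q + F i xs p * ∂ q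
    ∂-shuffle [] q _ = sym (trans (cong₂ _+_ (zeroˡ (F i xs q)) (cong (_* ∂ q) χ.unit-1))
      (solve 1 (λ d → con 0 :+ con 1 :* d := d :+ con 0) refl (∂ q)))
    ∂-shuffle (x ∷ p) [] _ = sym (cong₂ _+_ (trans (cong (∂ (x ∷ p) *_) χ.unit-1) (*-identityʳ _)) (zeroʳ _))
    ∂-shuffle (x ∷ p) (y ∷ q) dj@(_ ∷ dp) = begin
      Σw ∂ (map (x ∷_) As ++ map (y ∷_) Bs)
        ≡⟨ Σw-++ ∂ (map (x ∷_) As) (map (y ∷_) Bs) ⟩
      Σw ∂ (map (x ∷_) As) + Σw ∂ (map (y ∷_) Bs)
        ≡⟨ cong₂ _+_ (pull x As) (pull y Bs) ⟩
      a * Σw (F i xs) As + b * Σw (F i xs) Bs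
        ≡⟨ cong₂ (λ s t → a * s + b * t) (χ.multiplicative p (y ∷ q) dp)
             (χ.multiplicative (x ∷ p) q (disjoint-tailʳ dj)) ⟩
      a * (F i xs p * F i xs (y ∷ q)) + b * (F i xs (x ∷ p) * F i xs q)
        ≡⟨ solve 6 (λ a b f f′ g g′ → a :* (f :* g′) :+ b :* (f′ :* g) := a :* f :* g′ :+ f′ :* (b :* g)) refl
             a b (F i xs p) (F i xs (x ∷ p)) (F i xs q) (F i xs (y ∷ q)) ⟩
      ∂ (x ∷ p) * F i xs (y ∷ q) + F i xs (x ∷ p) * ∂ (y ∷ q) ∎
      where
      open ≡-Reasoning
      As = shuffle p (y ∷ q)
      Bs = shuffle (x ∷ p) q
      a = ι (weight i (val x))
      b = ι (weight i (val y))
      pull : ∀ z ws → Σw ∂ (map (z ∷_) ws) ≡ ι (weight i (val z)) * Σw (F i xs) ws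
      pull z [] = sym (zeroʳ _)
      pull z (w ∷ ws) = trans (cong (∂ (z ∷ w) +_) (pull z ws)) (sym (distribˡ _ _ _))

    -- Because ε² = 0, multiplicativity of F + ε ∂ amounts to the Leibniz rule for ∂. The shift of
    -- colours is harmless since weights depend on values only.
    perturbed-character : Character perturbed
    perturbed-character = record
      { unit-1 = trans (cong₂ _+_ χ.unit-1 (zeroʳ ε)) (+-identityʳ _)
      ; multiplicative = mult
      ; shift = λ { k [] → refl
                  ; k (z ∷ u) → cong₂ (λ s t → s + ε * (ι (weight i (val z)) * t)) (χ.shift k (z ∷ u)) (χ.shift k u) } }
      where
      open ≡-Reasoning
      split : ∀ ws → Σw perturbed ws ≡ Σw (F i xs) ws + ε * Σw ∂ ws
      split [] = sym (trans (+-identityˡ _) (zeroʳ ε))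
      split (w ∷ ws) = trans (cong (perturbed w +_) (split ws))
        (solve 5 (λ ε f d F D → (f :+ ε :* d) :+ (F :+ ε :* D) := (f :+ F) :+ ε :* (d :+ D)) refl
          ε (F i xs w) (∂ w) (Σw (F i xs) ws) (Σw ∂ ws))
      mult : Multiplicative perturbed
      mult p q dj = begin
        Σw perturbed (shuffle p q)                              ≡⟨ split (shuffle p q) ⟩
        Σw (F i xs) (shuffle p q) + ε * Σw ∂ (shuffle p q)
          ≡⟨ cong₂ (λ s t → s + ε * t) (χ.multiplicative p q dj) (∂-shuffle p q dj) ⟩
        f * g + ε * (∂ p * g + f * ∂ q)                         ≡⟨ drop-ε² _ (∂ p * ∂ q) ⟨
        f * g + ε * (∂ p * g + f * ∂ q) + ε * (ε * (∂ p * ∂ q))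
          ≡⟨ solve 5 (λ ε f g d e → f :* g :+ ε :* (d :* g :+ f :* e) :+ ε :* (ε :* (d :* e))
               := (f :+ ε :* d) :* (g :+ ε :* e)) refl ε f g (∂ p) (∂ q) ⟩
        perturbed p * perturbed q ∎
        where
        f = F i xs p
        g = F i xs q

    module _ {h : ℤ} (i+n≡h : i ℤ.+ (ℤ.+ n) ≡ h) where

      -- Applying E first strips the first letter and leaves its weight. The lower bound matters:
      -- `∂` weights every first letter, while E contains only the generators of the window.
      perturbed-δ : ∀ {q} → All (i ℤ.≤_) q → Good h q →
                    perturbed (emb q) ≡ P i xs (D i n (δ (emb q)))
      perturbed-δ {q} lo γ = trans (cong₂ (λ s t → s + ε * t) (F≡P i xs i+n≡h γ) (tail lo γ))
        (sym (lin-+* (P-linear i xs) (δ (emb q)) ε (E i n (δ (emb q)))))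
        where
        tail : ∀ {q} → All (i ℤ.≤_) q → Good h q → ∂ (emb q) ≡ P i xs (E i n (δ (emb q)))
        tail [] [] = sym (trans (lin-cong (P-linear i xs) (E-δ-[] i n)) (lin-0 (P-linear i xs)))
        tail {z ∷ q} (i≤z ∷ _) (cons z<h _ γ) = sym (trans
          (lin-cong (P-linear i xs) (λ p → E-δ i n (emb q) p i≤z (subst (z ℤ.<_) (sym i+n≡h) z<h)))
          (trans (lin-* (P-linear i xs) (ι (weight i z)) (δ (emb q)))
            (cong (ι (weight i z) *_) (sym (F≡P i xs i+n≡h γ)))))

      -- The characters need not agree word by word. Both sides are rewritten as values on the whole
      -- coefficient function of `s`, which satisfies the nilCoxeter relations, so that `P-D`
      -- applies.
      sch-agree : ∀ {w s} → IsSch w s → Keys (All (λ z → i ℤ.≤ val z × val z ℤ.< h)) s →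
                  eval translated s ≡ eval perturbed s
      sch-agree {w} {s} sch ks = begin
        eval translated s
          ≡⟨ eval-support _≟W_ s ks (λ u b → on-support u b {translated} {λ v → P i ys (δ v)} (λ γ lo → F≡P i ys i+n≡h γ)) ⟩
        eval (λ u → P i ys (δ u)) s
          ≡⟨ eval-δ (P-linear i ys) s ⟩
        P i ys ρ
          ≡⟨ P-D i xs nil-ρ ⟩
        P i xs (D i n ρ)
          ≡⟨ eval-δ (linear-∘ (P-linear i xs) (D-linear i n)) s ⟨
        eval (λ u → P i xs (D i n (δ u))) s
          ≡⟨ eval-support _≟W_ s ks (λ u b → on-support u b {perturbed} {λ v → P i xs (D i n (δ v))} (λ γ lo → perturbed-δ lo γ)) ⟨
        eval perturbed s ∎
        where
        open ≡-Reasoning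
        open Sch {w} {s} sch
        ys = Vec.map (_+ ε) xs
        ρ : Fn
        ρ p = ι (coeff s (emb p))
        nil-ρ : Nil ρ
        nil-ρ = record
          { square = λ p i q → trans (cong ι (coeff-square p i q)) ι-0
          ; comm = λ p q l → cong ι (coeff-comm p q l)
          ; braid = λ p i q → cong ι (coeff-braid p i q) }
        vanish : ∀ u {f g : Word → K} → coeff s u ≡ 0ℚ →
                 ι (kcoeff _≟W_ s u) * f u ≡ ι (kcoeff _≟W_ s u) * g u
        vanish u {f} {g} c≡0 = trans (to-0 f) (sym (to-0 g))
          where
          to-0 : ∀ f → ι (kcoeff _≟W_ s u) * f u ≡ 0#
          to-0 f = trans (cong (λ c → ι c * f u) (trans (sym (coeff-kcoeff s u)) c≡0))
            (trans (cong (_* f u) ι-0) (zeroˡ (f u)))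
        -- The list `s` may contain words that are coloured or have equal neighbours, but their
        -- total coefficient is 0; all other words are good.
        on-support : ∀ u → All (λ z → i ℤ.≤ val z × val z ℤ.< h) u → {f g : Word → K} →
          (∀ {q} → Good h q → All (i ℤ.≤_) q → f (emb q) ≡ g (emb q)) →
          ι (kcoeff _≟W_ s u) * f u ≡ ι (kcoeff _≟W_ s u) * g u
        on-support u b {f} {g} e with All.all? (λ l → proj₂ l ℕP.≟ 0) u
        ... | no coloured = vanish u {f} {g} (proj₂ (sch u) (coloured ∘ proj₁))
        ... | yes uncoloured with good-or-square (map val u) (AllP.map⁺ (All.map proj₂ b))
        ... | inj₁ γ = cong (ι (kcoeff _≟W_ s u) *_)
              (subst (λ v → f v ≡ g v) (sym (uncoloured⇒emb u uncoloured)) (e γ (AllP.map⁺ (All.map proj₁ b))))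
        ... | inj₂ (p , j , r , eq) = vanish u {f} {g} (trans
              (cong (coeff s) (trans (uncoloured⇒emb u uncoloured) (cong emb eq))) (coeff-square p j r))

  -- Agreement is stated for all large windows from -M to M - 1, so that the operands of a sum or
  -- product can be compared in a common one.
  ℛ-agree : ∀ {a} → Inℛ a → ∃ λ N → ∀ M → N ℕ.≤ M → ∀ (xs : Vec K (M ℕ.+ M)) →
            eval (translated (ℤ.- (ℤ.+ M)) xs) a ≡ eval (perturbed (ℤ.- (ℤ.+ M)) xs) a
  ℛ-agree (gen {s} w sch) with bound-𝒬 s
  ... | N , b = N , λ M N≤M xs → sch-agree (ℤ.- (ℤ.+ M)) xs (-N+[N+N] M) {w} {s} sch
        (All.map (All.map (λ {z} l → ∣z∣<N⇒-N≤z (val z) (ℕP.≤-trans l N≤M) , ∣z∣<N⇒z<N (val z) (ℕP.≤-trans l N≤M))) b)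
  ℛ-agree unit = 0 , λ M _ xs → cong (λ k → ι 1ℚ * k + 0#) (trans
    (Character.unit-1 (F-character (ℤ.- (ℤ.+ M)) (Vec.map (_+ ε) xs)))
    (sym (Character.unit-1 (perturbed-character (ℤ.- (ℤ.+ M)) xs))))
  ℛ-agree (add {a} {b} ra rb) with ℛ-agree ra | ℛ-agree rb
  ... | N , ea | N′ , eb = N ℕ.⊔ N′ , λ M l xs →
        trans (eval-++ _ a b) (trans (cong₂ _+_ (ea M (ℕP.m⊔n≤o⇒m≤o N N′ l) xs) (eb M (ℕP.m⊔n≤o⇒n≤o N N′ l) xs))
          (sym (eval-++ _ a b)))
  ℛ-agree (smul {a} c ra) with ℛ-agree ra
  ... | N , ea = N , λ M l xs →
        trans (eval-scale _ c a) (trans (cong (ι c *_) (ea M l xs)) (sym (eval-scale _ c a)))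
  ℛ-agree (mul {a} {b} ra rb) with ℛ-agree ra | ℛ-agree rb
  ... | N , ea | N′ , eb = N ℕ.⊔ N′ , λ M l xs →
        trans (eval-⊛ (F-character (ℤ.- (ℤ.+ M)) (Vec.map (_+ ε) xs)) a b)
          (trans (cong₂ _*_ (ea M (ℕP.m⊔n≤o⇒m≤o N N′ l) xs) (eb M (ℕP.m⊔n≤o⇒n≤o N N′ l) xs))
            (sym (eval-⊛ (perturbed-character (ℤ.- (ℤ.+ M)) xs) a b)))
  ℛ-agree (resp {a} {b} a≈b ra) with ℛ-agree ra
  ... | N , ea = N , λ M l xs → trans (sym (eval-resp _≟W_ _ a b eq)) (trans (ea M l xs) (eval-resp _≟W_ _ a b eq))
    where
    eq : ∀ u → kcoeff _≟W_ a u ≡ kcoeff _≟W_ b u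
    eq u = trans (sym (coeff-kcoeff a u)) (trans (a≈b u) (coeff-kcoeff b u))

  eval-perturbed : ∀ {n} i (xs : Vec K n) a →
    eval (perturbed i xs) a ≡ eval (F i xs) a + ε * (eval (F i xs) (∇ a) + ι (1ℚ ℚ.- (i ℚ./ 1)) * eval (F i xs) (ξ a))
  eval-perturbed i xs a = trans (eval-+* (F i xs) (∂ i xs) ε a) (cong (λ s → eval (F i xs) a + ε * s) (go a))
    where
    κ = 1ℚ ℚ.- (i ℚ./ 1)
    go : ∀ a → eval (∂ i xs) a ≡ eval (F i xs) (∇ a) + ι κ * eval (F i xs) (ξ a)
    go [] = sym (trans (+-identityˡ _) (zeroʳ _))
    go ((c , []) ∷ a) = trans (cong₂ _+_ (zeroʳ _) (go a)) (+-identityˡ _)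
    go ((c , z ∷ u) ∷ a) = trans
      (cong₂ (λ s t → ι c * (s * F i xs u) + t) (ι-+ (val z ℚ./ 1) κ) (go a))
      (trans (solve 6 (λ c v k f x y → c :* ((v :+ k) :* f) :+ (x :+ k :* y) := (c :* v :* f :+ x) :+ k :* (c :* f :+ y)) refl
               (ι c) (ι (val z ℚ./ 1)) (ι κ) (F i xs u) (eval (F i xs) (∇ a)) (eval (F i xs) (ξ a)))
        (cong (λ s → (s * F i xs u + eval (F i xs) (∇ a)) + ι κ * (ι c * F i xs u + eval (F i xs) (ξ a)))
          (sym (ι-* c (val z ℚ./ 1)))))

ℚ-scalars : Scalars
ℚ-scalars = record
  { isCommutativeSemiring = IsCommutativeRing.isCommutativeSemiring ℚP.+-*-isCommutativeRing
  ; ι = λ q → q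
  ; ι-+ = λ _ _ → refl ; ι-* = λ _ _ → refl ; ι-0 = refl ; ι-1 = refl }

-- Vanishing of polynomials, and linear independence of slide polynomials

hsum : ℕ → (ℕ → ℚ) → ℚ → ℚ
hsum zero    f x = 0ℚ
hsum (suc n) f x = f 0 ℚ.+ x ℚ.* hsum n (f ∘ suc) x

hsum-0 : ∀ n f x → (∀ e → e ℕ.< n → f e ≡ 0ℚ) → hsum n f x ≡ 0ℚ
hsum-0 zero f x h = refl
hsum-0 (suc n) f x h = trans
  (cong₂ (λ s t → s ℚ.+ x ℚ.* t) (h 0 (ℕ.s≤s ℕ.z≤n)) (hsum-0 n (f ∘ suc) x (λ e l → h (suc e) (ℕ.s≤s l))))
  (trans (ℚP.+-identityˡ _) (ℚP.*-zeroʳ x))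

hsum-+* : ∀ n f g c x → hsum n (λ e → c ℚ.* f e ℚ.+ g e) x ≡ c ℚ.* hsum n f x ℚ.+ hsum n g x
hsum-+* zero f g c x = sym (trans (ℚP.+-identityʳ _) (ℚP.*-zeroʳ c))
hsum-+* (suc n) f g c x = trans
  (cong (λ s → (c ℚ.* f 0 ℚ.+ g 0) ℚ.+ x ℚ.* s) (hsum-+* n (f ∘ suc) (g ∘ suc) c x))
  (solve 6 (λ c x f g F G → (c :* f :+ g) :+ x :* (c :* F :+ G) := c :* (f :+ x :* F) :+ (g :+ x :* G)) refl
    c x (f 0) (g 0) (hsum n (f ∘ suc) x) (hsum n (g ∘ suc) x))
  where open +-*-Solver

-- The coefficients of (1 + b) g(2x) - g(x).
dilate : ℚ → (ℕ → ℚ) → ℕ → ℚ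
dilate b g zero    = b ℚ.* g 0
dilate b g (suc e) = dilate (1ℚ ℚ.+ (b ℚ.+ b)) (g ∘ suc) e

hsum-dilate : ∀ n b g x → hsum n (dilate b g) x ℚ.+ hsum n g x ≡ (1ℚ ℚ.+ b) ℚ.* hsum n g (x ℚ.+ x)
hsum-dilate zero b g x = sym (ℚP.*-zeroʳ (1ℚ ℚ.+ b))
hsum-dilate (suc n) b g x = begin
  (b ℚ.* g 0 ℚ.+ x ℚ.* d) ℚ.+ (g 0 ℚ.+ x ℚ.* s)
    ≡⟨ solve 5 (λ b x g d s → (b :* g :+ x :* d) :+ (g :+ x :* s) := (con 1ℚ :+ b) :* g :+ x :* (d :+ s)) refl b x (g 0) d s ⟩
  (1ℚ ℚ.+ b) ℚ.* g 0 ℚ.+ x ℚ.* (d ℚ.+ s)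
    ≡⟨ cong (λ k → (1ℚ ℚ.+ b) ℚ.* g 0 ℚ.+ x ℚ.* k) (hsum-dilate n (1ℚ ℚ.+ (b ℚ.+ b)) (g ∘ suc) x) ⟩
  (1ℚ ℚ.+ b) ℚ.* g 0 ℚ.+ x ℚ.* ((1ℚ ℚ.+ (1ℚ ℚ.+ (b ℚ.+ b))) ℚ.* t)
    ≡⟨ solve 4 (λ b x g t → (con 1ℚ :+ b) :* g :+ x :* ((con 1ℚ :+ (con 1ℚ :+ (b :+ b))) :* t)
         := (con 1ℚ :+ b) :* (g :+ (x :+ x) :* t)) refl b x (g 0) t ⟩
  (1ℚ ℚ.+ b) ℚ.* (g 0 ℚ.+ (x ℚ.+ x) ℚ.* t) ∎
  where
  open ≡-Reasoning
  open +-*-Solver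
  d = hsum n (dilate (1ℚ ℚ.+ (b ℚ.+ b)) (g ∘ suc)) x
  s = hsum n (g ∘ suc) x
  t = hsum n (g ∘ suc) (x ℚ.+ x)

pos*q≡0⇒q≡0 : ∀ p q → 0ℚ ℚ.< p → p ℚ.* q ≡ 0ℚ → q ≡ 0ℚ
pos*q≡0⇒q≡0 p q 0<p pq≡0 = begin
  q                       ≡⟨ ℚP.*-identityˡ q ⟨
  1ℚ ℚ.* q                ≡⟨ cong (ℚ._* q) (ℚP.*-inverseˡ p) ⟨
  ((ℚ.1/ p) ℚ.* p) ℚ.* q  ≡⟨ ℚP.*-assoc (ℚ.1/ p) p q ⟩
  (ℚ.1/ p) ℚ.* (p ℚ.* q)  ≡⟨ cong ((ℚ.1/ p) ℚ.*_) pq≡0 ⟩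
  (ℚ.1/ p) ℚ.* 0ℚ         ≡⟨ ℚP.*-zeroʳ (ℚ.1/ p) ⟩
  0ℚ                      ∎
  where
  open ≡-Reasoning
  instance
    p≢0 : ℚ.NonZero p
    p≢0 = ℚP.pos⇒nonZero p {{ℚ.positive 0<p}}

0<1 : 0ℚ ℚ.< 1ℚ
0<1 = ℚP.positive⁻¹ 1ℚ

0<p+p : ∀ {p} → 0ℚ ℚ.< p → 0ℚ ℚ.< p ℚ.+ p
0<p+p 0<p = ℚP.+-mono-< 0<p 0<p

-- `dilate b g e` equals ((1 + b) 2^e - 1) g(e), and the factor is positive; the recursion replaces
-- 1 + b by 2 (1 + b).
dilate-≡0 : ∀ b g e → 0ℚ ℚ.< b → dilate b g e ≡ 0ℚ → g e ≡ 0ℚ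
dilate-≡0 b g zero 0<b h = pos*q≡0⇒q≡0 b (g 0) 0<b h
dilate-≡0 b g (suc e) 0<b h = dilate-≡0 _ (g ∘ suc) e (ℚP.+-mono-< 0<1 (0<p+p 0<b)) h

-- Comparing the values at x and 2x eliminates the constant coefficient.
hsum-≡0 : ∀ n f → (∀ x → 0ℚ ℚ.< x → hsum n f x ≡ 0ℚ) → ∀ e → e ℕ.< n → f e ≡ 0ℚ
hsum-≡0 (suc n) f h = go
  where
  open ≡-Reasoning
  open +-*-Solver
  g = f ∘ suc
  -- With f(x) = f(0) + x g(x), the difference f(2x) - f(x) is x (2 g(2x) - g(x)); hence the
  -- parameter 1 of `dilate`, and positive x to divide by.
  difference : ∀ x → 0ℚ ℚ.< x → hsum n (dilate 1ℚ g) x ≡ 0ℚ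
  difference x 0<x = pos*q≡0⇒q≡0 x d 0<x (begin
    x ℚ.* d
      ≡⟨ solve 4 (λ x d s f → x :* d := (f :+ x :* (d :+ s)) :- (f :+ x :* s)) refl x d s (f 0) ⟩
    (f 0 ℚ.+ x ℚ.* (d ℚ.+ s)) ℚ.- (f 0 ℚ.+ x ℚ.* s)
      ≡⟨ cong₂ (λ k l → (f 0 ℚ.+ x ℚ.* k) ℚ.- l) (hsum-dilate n 1ℚ g x) (h x 0<x) ⟩
    (f 0 ℚ.+ x ℚ.* ((1ℚ ℚ.+ 1ℚ) ℚ.* t)) ℚ.- 0ℚ
      ≡⟨ solve 3 (λ x f t → (f :+ x :* ((con 1ℚ :+ con 1ℚ) :* t)) :- con 0ℚ := f :+ (x :+ x) :* t) refl x (f 0) t ⟩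
    f 0 ℚ.+ (x ℚ.+ x) ℚ.* t
      ≡⟨ h (x ℚ.+ x) (0<p+p 0<x) ⟩
    0ℚ ∎)
    where
    d = hsum n (dilate 1ℚ g) x
    s = hsum n g x
    t = hsum n g (x ℚ.+ x)
  g≡0 : ∀ e → e ℕ.< n → g e ≡ 0ℚ
  g≡0 e l = dilate-≡0 1ℚ g e 0<1 (hsum-≡0 n (dilate 1ℚ g) difference e l)
  go : ∀ e → e ℕ.< suc n → f e ≡ 0ℚ
  go zero _ = begin
    f 0                          ≡⟨ ℚP.+-identityʳ (f 0) ⟨
    f 0 ℚ.+ 1ℚ ℚ.* 0ℚ            ≡⟨ cong (λ k → f 0 ℚ.+ 1ℚ ℚ.* k) (hsum-0 n g 1ℚ g≡0) ⟨
    f 0 ℚ.+ 1ℚ ℚ.* hsum n g 1ℚ   ≡⟨ h 1ℚ 0<1 ⟩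
    0ℚ                           ∎
  go (suc e) (ℕ.s≤s l) = g≡0 e l

Ascending : List ℤ → Set
Ascending = Linked ℤ._≤_

-- There is no lower bound because ascents between letters of equal value push row entries below all
-- values of the word.
RowOK : ℤ → List ℤ → Set
RowOK h r = Ascending r × All (ℤ._< h) r

-- What remains of a row after the factor x_L^e has been read off its slide polynomial.
cut : ℤ → ℕ → Maybe Letter → List ℤ → Maybe (List ℤ)
cut L zero    b r = just r
cut L (suc e) b [] = nothing
cut L (suc e) b (t ∷ r) = if ok L b (t , 0) then cut L e (just (t , 0)) r else nothing

cut-preserves : ∀ {P : List ℤ → Set} → (∀ {t r} → P (t ∷ r) → P r) →
                ∀ L e b {r r′} → cut L e b r ≡ just r′ → P r → P r′
cut-preserves tl L zero b refl p = p
cut-preserves tl L (suc e) b {t ∷ r} eq p with ok L b (t , 0)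
... | true = cut-preserves tl L e (just (t , 0)) eq (tl p)

rowOK-tail : ∀ {h t r} → RowOK h (t ∷ r) → RowOK h r
rowOK-tail (asc , _ ∷ below) = Linked.tail asc , below

cut-run : ∀ L e v → cut L e (just (L , 0)) (replicate e L ++ v) ≡ just v
cut-run L zero v = refl
cut-run L (suc e) v rewrite dec-true (L ℤP.≤? L) ℤP.≤-refl | ⊀⇒≮L (L , 0) (L , 0) ≺-irrefl = cut-run L e v

cut-run⁻¹ : ∀ L e r {v} → cut L e (just (L , 0)) r ≡ just v → r ≡ replicate e L ++ v
cut-run⁻¹ L zero r refl = refl
cut-run⁻¹ L (suc e) (t ∷ r) eq with ℤP.<-cmp L t
... | tri≈ _ refl _ rewrite dec-true (L ℤP.≤? L) ℤP.≤-refl | ⊀⇒≮L (L , 0) (L , 0) ≺-irrefl =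
      cong (L ∷_) (cut-run⁻¹ L e r eq)
cut-run⁻¹ L (suc e) (t ∷ r) eq | tri> _ _ t<L rewrite dec-false (L ℤP.≤? t) (ℤP.<⇒≱ t<L) with eq
... | ()
cut-run⁻¹ L (suc e) (t ∷ r) eq | tri< L<t _ _
  rewrite dec-true (L ℤP.≤? t) (ℤP.<⇒≤ L<t) | ≺⇒<L (L , 0) (t , 0) (inj₁ L<t) with eq
... | ()

-- After an entry equal to L the run must stay at L, as a larger entry would be an ascent. A run may
-- also start above L, but then the whole ascending row lies above L.
cut-ascending : ∀ L e r {v} → Ascending r → cut L (suc e) nothing r ≡ just v →
                r ≡ replicate (suc e) L ++ v ⊎ Ascending (ℤ.suc L ∷ r)
cut-ascending L e (t ∷ r) asc eq with ℤP.<-cmp L t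
... | tri< L<t _ _ = inj₂ (ℤP.i<j⇒suc[i]≤j L<t ∷ asc)
... | tri≈ _ refl _ rewrite dec-true (L ℤP.≤? L) ℤP.≤-refl = inj₁ (cong (L ∷_) (cut-run⁻¹ L e r eq))
... | tri> _ _ t<L rewrite dec-false (L ℤP.≤? t) (ℤP.<⇒≱ t<L) with eq
... | ()

leading-run : ∀ i v → Ascending (i ∷ v) → ∃ λ e → ∃ λ v′ → v ≡ replicate e i ++ v′ × Ascending (ℤ.suc i ∷ v′)
leading-run i [] _ = 0 , [] , refl , [-]
leading-run i (t ∷ v) (i≤t ∷ asc) with i ℤP.≟ t
... | no i≢t = 0 , t ∷ v , refl , ℤP.i<j⇒suc[i]≤j (ℤP.≤∧≢⇒< i≤t i≢t) ∷ asc
... | yes refl with leading-run i v asc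
... | e , v′ , refl , asc′ = suc e , v′ , refl , asc′

cutLC : ℤ → ℕ → LC (List ℤ) → LC (List ℤ)
cutLC L e [] = []
cutLC L e ((c , r) ∷ a) = maybe′ (λ r′ → (c , r′) ∷ cutLC L e a) (cutLC L e a) (cut L e nothing r)

cutLC-zero : ∀ L a → cutLC L 0 a ≡ a
cutLC-zero L [] = refl
cutLC-zero L (t ∷ a) = cong (t ∷_) (cutLC-zero L a)

cutLC-rowOK : ∀ {h} L e {a} → Keys (RowOK h) a → Keys (RowOK h) (cutLC L e a)
cutLC-rowOK L e {[]} [] = []
cutLC-rowOK {h} L e {(c , r) ∷ a} (k ∷ ks) with cut L e nothing r in eq
... | nothing = cutLC-rowOK L e ks
... | just r′ = cut-preserves {RowOK h} rowOK-tail L e nothing eq k ∷ cutLC-rowOK L e ks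

module Independence where
  open Evaluation ℚ-scalars
  open Slides ℚ-scalars

  indicator : List ℤ → List ℤ → ℚ
  indicator v r = if does (r ≟R v) then 1ℚ else 0ℚ

  kcoeff-eval : ∀ a v → kcoeff _≟R_ a v ≡ eval (indicator v) a
  kcoeff-eval [] v = refl
  kcoeff-eval ((c , r) ∷ a) v = cong₂ ℚ._+_ (term (does (r ≟R v))) (kcoeff-eval a v)
    where
    term : ∀ d → (if d then c else 0ℚ) ≡ c ℚ.* (if d then 1ℚ else 0ℚ)
    term true  = sym (ℚP.*-identityʳ c)
    term false = sym (ℚP.*-zeroʳ c)

  eval-cutLC : ∀ (f : List ℤ → ℚ) L e a → eval f (cutLC L e a) ≡ eval (maybe′ f 0ℚ ∘ cut L e nothing) a
  eval-cutLC f L e [] = refl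
  eval-cutLC f L e ((c , r) ∷ a) with cut L e nothing r
  ... | just r′ = cong (c ℚ.* f r′ ℚ.+_) (eval-cutLC f L e a)
  ... | nothing = trans (eval-cutLC f L e a)
        (sym (trans (cong (ℚ._+ rest) (ℚP.*-zeroʳ c)) (ℚP.+-identityˡ rest)))
    where rest = eval (maybe′ f 0ℚ ∘ cut L e nothing) a

  W-hsum : ∀ L x g N b r → length r ℕ.< N →
           W L x g b (emb r) ≡ hsum N (λ e → maybe′ (g ∘ emb) 0ℚ (cut L e b r)) x
  W-hsum L x g (suc N) b [] l = sym (trans
    (cong (λ k → g [] ℚ.+ x ℚ.* k) (hsum-0 N (λ _ → 0ℚ) x (λ _ _ → refl)))
    (trans (cong (g [] ℚ.+_) (ℚP.*-zeroʳ x)) (ℚP.+-identityʳ (g []))))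
  W-hsum L x g (suc N) b (t ∷ r) (ℕ.s≤s l) with ok L b (t , 0)
  ... | true  = cong (λ k → g (emb (t ∷ r)) ℚ.+ x ℚ.* k) (W-hsum L x g N (just (t , 0)) r l)
  ... | false = cong (g (emb (t ∷ r)) ℚ.+_)
        (sym (trans (cong (x ℚ.*_) (hsum-0 N (λ _ → 0ℚ) x (λ _ _ → refl))) (ℚP.*-zeroʳ x)))

  eval-W : ∀ L x g N a → Keys (λ r → length r ℕ.< N) a →
           eval (W L x g nothing ∘ emb) a ≡ hsum N (λ e → eval (maybe′ (g ∘ emb) 0ℚ ∘ cut L e nothing) a) x
  eval-W L x g N [] [] = sym (hsum-0 N (λ _ → 0ℚ) x (λ _ _ → refl))
  eval-W L x g N ((c , r) ∷ a) (l ∷ ls) = trans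
    (cong₂ (λ s t → c ℚ.* s ℚ.+ t) (W-hsum L x g N nothing r l) (eval-W L x g N a ls))
    (sym (hsum-+* N (λ e → maybe′ (g ∘ emb) 0ℚ (cut L e nothing r))
      (λ e → eval (maybe′ (g ∘ emb) 0ℚ ∘ cut L e nothing) a) c x))

  bound-length : ∀ (a : LC (List ℤ)) e → ∃ λ N → e ℕ.< N × Keys (λ r → length r ℕ.< N) a
  bound-length [] e = suc e , ℕP.≤-refl , []
  bound-length ((c , r) ∷ a) e with bound-length a e
  ... | N , l , ls = suc (length r) ℕ.⊔ N , ℕP.≤-trans l (ℕP.m≤n⊔m _ N)
        , ℕP.m≤m⊔n _ N ∷ All.map (λ h → ℕP.≤-trans h (ℕP.m≤n⊔m _ N)) ls

  -- The coefficient of x_i^e detects the rows that start with a run of e equal entries ≥ i;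
  -- among these, the rows with entries > i have coefficient 0 by the case e = 0.
  slides-independent : ∀ n i {h} a → i ℤ.+ (ℤ.+ n) ≡ h → Keys (RowOK h) a →
    (∀ (xs : Vec ℚ n) → eval (F i xs ∘ emb) a ≡ 0ℚ) → ∀ v → Ascending (i ∷ v) → kcoeff _≟R_ a v ≡ 0ℚ
  slides-independent zero i a eq ks hyp [] asc =
    trans (kcoeff-eval a []) (trans (eval-ext (λ { [] → refl ; (_ ∷ _) → refl }) a) (hyp []))
  slides-independent zero i a refl ks hyp (t ∷ v) (i≤t ∷ _) = kcoeff-absent _≟R_ a
    (All.map (λ { (_ , t<h ∷ _) refl → ℤP.<⇒≱ (subst (t ℤ.<_) (ℤP.+-identityʳ i) t<h) i≤t }) ks)
  slides-independent (suc n) i {h} a eq ks hyp v asc with leading-run i v asc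
  ... | e , v′ , refl , asc′ = conclude e
    where
    cut-zero : ∀ e v → Ascending (ℤ.suc i ∷ v) → kcoeff _≟R_ (cutLC i e a) v ≡ 0ℚ
    cut-zero e = slides-independent n (ℤ.suc i) (cutLC i e a) (trans (sym (i+suc[c] i n)) eq) (cutLC-rowOK i e ks)
      λ xs → trans (eval-cutLC (F (ℤ.suc i) xs ∘ emb) i e a) (coefficient xs)
      where
      coefficient : ∀ xs → eval (maybe′ (F (ℤ.suc i) xs ∘ emb) 0ℚ ∘ cut i e nothing) a ≡ 0ℚ
      coefficient xs with bound-length a e
      ... | N , e<N , ls = hsum-≡0 N _
              (λ x _ → trans (sym (eval-W i x (F (ℤ.suc i) xs) N a ls)) (hyp (x ∷ xs))) e e<N
    high : ∀ v → Ascending (ℤ.suc i ∷ v) → kcoeff _≟R_ a v ≡ 0ℚ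
    high v asc = subst (λ a → kcoeff _≟R_ a v ≡ 0ℚ) (cutLC-zero i a) (cut-zero 0 v asc)
    conclude : ∀ e → kcoeff _≟R_ a (replicate e i ++ v′) ≡ 0ℚ
    conclude zero = high v′ asc′
    conclude (suc e) = begin
      kcoeff _≟R_ a w                                          ≡⟨ kcoeff-eval a w ⟩
      eval (indicator w) a                                     ≡⟨ eval-support _≟R_ {P = RowOK h} a ks compare ⟩
      eval (maybe′ (indicator v′) 0ℚ ∘ cut i (suc e) nothing) a ≡⟨ eval-cutLC (indicator v′) i (suc e) a ⟨
      eval (indicator v′) (cutLC i (suc e) a)                  ≡⟨ kcoeff-eval (cutLC i (suc e) a) v′ ⟨
      kcoeff _≟R_ (cutLC i (suc e) a) v′                       ≡⟨ cut-zero (suc e) v′ asc′ ⟩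
      0ℚ                                                       ∎
      where
      open ≡-Reasoning
      w = replicate (suc e) i ++ v′
      cut-w : cut i (suc e) nothing w ≡ just v′
      cut-w rewrite dec-true (i ℤP.≤? i) ℤP.≤-refl = cut-run i e v′
      indicator-self : ∀ v → indicator v v ≡ 1ℚ
      indicator-self v rewrite dec-true (v ≟R v) refl = refl
      compare : ∀ r → RowOK h r → kcoeff _≟R_ a r ℚ.* indicator w r ≡
                kcoeff _≟R_ a r ℚ.* maybe′ (indicator v′) 0ℚ (cut i (suc e) nothing r)
      compare r (asc , _) with r ≟R w
      ... | yes refl rewrite cut-w = cong (kcoeff _≟R_ a w ℚ.*_) (sym (indicator-self v′))
      ... | no r≢w with cut i (suc e) nothing r in eq
      ... | nothing = refl
      ... | just r′ with r′ ≟R v′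
      ... | no _ = refl
      ... | yes refl with cut-ascending i e r asc eq
      ... | inj₁ r≡w = ⊥-elim (r≢w r≡w)
      ... | inj₂ asc″ rewrite high r asc″ = refl

-- The dual numbers: the pair (a , b) stands for a + b ε

module Dual where
  open import Algebra.Definitions {A = ℚ × ℚ} _≡_
  open +-*-Solver

  infixl 6 _⊕_
  infixl 7 _⊗_
  _⊕_ _⊗_ : ℚ × ℚ → ℚ × ℚ → ℚ × ℚ
  (a , b) ⊕ (c , d) = a ℚ.+ c , b ℚ.+ d
  (a , b) ⊗ (c , d) = a ℚ.* c , a ℚ.* d ℚ.+ b ℚ.* c

  ⊕-assoc : Associative _⊕_
  ⊕-assoc (a , b) (c , d) (e , f) = cong₂ _,_ (ℚP.+-assoc a c e) (ℚP.+-assoc b d f)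

  ⊕-comm : Commutative _⊕_
  ⊕-comm (a , b) (c , d) = cong₂ _,_ (ℚP.+-comm a c) (ℚP.+-comm b d)

  ⊕-identityˡ : LeftIdentity (0ℚ , 0ℚ) _⊕_
  ⊕-identityˡ (a , b) = cong₂ _,_ (ℚP.+-identityˡ a) (ℚP.+-identityˡ b)

  ⊗-assoc : Associative _⊗_
  ⊗-assoc (a , b) (c , d) (e , f) = cong₂ _,_ (ℚP.*-assoc a c e)
    (solve 6 (λ a b c d e f → (a :* c) :* f :+ (a :* d :+ b :* c) :* e := a :* (c :* f :+ d :* e) :+ b :* (c :* e))
      refl a b c d e f)

  ⊗-comm : Commutative _⊗_
  ⊗-comm (a , b) (c , d) = cong₂ _,_ (ℚP.*-comm a c)
    (solve 4 (λ a b c d → a :* d :+ b :* c := c :* b :+ d :* a) refl a b c d)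

  ⊗-identityˡ : LeftIdentity (1ℚ , 0ℚ) _⊗_
  ⊗-identityˡ (a , b) = cong₂ _,_ (ℚP.*-identityˡ a)
    (solve 2 (λ a b → con 1ℚ :* b :+ con 0ℚ :* a := b) refl a b)

  ⊗-zeroˡ : LeftZero (0ℚ , 0ℚ) _⊗_
  ⊗-zeroˡ (a , b) = cong₂ _,_ (ℚP.*-zeroˡ a)
    (solve 2 (λ a b → con 0ℚ :* b :+ con 0ℚ :* a := con 0ℚ) refl a b)

  ⊗-distribʳ-⊕ : _⊗_ DistributesOverʳ _⊕_
  ⊗-distribʳ-⊕ (a , b) (c , d) (e , f) = cong₂ _,_ (ℚP.*-distribʳ-+ a c e)
    (solve 6 (λ a b c d e f → (c :+ e) :* b :+ (d :+ f) :* a := (c :* b :+ d :* a) :+ (e :* b :+ f :* a))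
      refl a b c d e f)

  isCommutativeSemiring : IsCommutativeSemiring _≡_ _⊕_ _⊗_ (0ℚ , 0ℚ) (1ℚ , 0ℚ)
  isCommutativeSemiring = isCommutativeSemiringˡ record
    { +-isCommutativeMonoid = isCommutativeMonoidˡ record
      { isSemigroup = record
        { isMagma = record { isEquivalence = isEquivalence ; ∙-cong = cong₂ _⊕_ } ; assoc = ⊕-assoc }
      ; identityˡ = ⊕-identityˡ
      ; comm = ⊕-comm }
    ; *-isCommutativeMonoid = isCommutativeMonoidˡ record
      { isSemigroup = record
        { isMagma = record { isEquivalence = isEquivalence ; ∙-cong = cong₂ _⊗_ } ; assoc = ⊗-assoc }
      ; identityˡ = ⊗-identityˡ
      ; comm = ⊗-comm }
    ; distribʳ = ⊗-distribʳ-⊕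
    ; zeroˡ = ⊗-zeroˡ }

  scalars : Scalars
  scalars = record
    { isCommutativeSemiring = isCommutativeSemiring
    ; ι = _, 0ℚ
    ; ι-+ = λ _ _ → refl
    ; ι-* = λ a b → cong (a ℚ.* b ,_)
        (solve 2 (λ a b → con 0ℚ := a :* con 0ℚ :+ con 0ℚ :* b) refl a b)
    ; ι-0 = refl
    ; ι-1 = refl }

  ε : ℚ × ℚ
  ε = 0ℚ , 1ℚ

  -- ε cannot be cancelled, but an equation ε d = 0 still determines the rational part of `d`, which
  -- at points without ε is the rational value of the slide polynomial.
  proj₂-ε⊗ : ∀ d → proj₂ (ε ⊗ d) ≡ proj₁ d
  proj₂-ε⊗ (a , b) = solve 2 (λ a b → con 0ℚ :* b :+ con 1ℚ :* a := a) refl a b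

-- Passage from ℚ[ε] back to ℚ, and compatibility of ξ and ∇ with `≡m`

private
  module Q where
    open Evaluation ℚ-scalars public
    open Slides ℚ-scalars public
    open RowInvariance ℚ-scalars public
  module D where
    open Evaluation Dual.scalars public
    open Slides Dual.scalars public
    open RowInvariance Dual.scalars public
    open Derivation Dual.scalars Dual.ε refl public

constants : ∀ {n} → Vec ℚ n → Vec (ℚ × ℚ) n
constants = Vec.map (_, 0ℚ)

proj₁-W : ∀ L x {f g} → (∀ u → proj₁ (f u) ≡ g u) → ∀ b u → proj₁ (D.W L (x , 0ℚ) f b u) ≡ Q.W L x g b u
proj₁-W L x h b [] = h []
proj₁-W L x h b (z ∷ u) with ok L b z
... | true  = cong₂ (λ s t → s ℚ.+ x ℚ.* t) (h (z ∷ u)) (proj₁-W L x h (just z) u)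
... | false = cong (ℚ._+ 0ℚ) (h (z ∷ u))

proj₁-F : ∀ {n} L (xs : Vec ℚ n) u → proj₁ (D.F L (constants xs) u) ≡ Q.F L xs u
proj₁-F L [] [] = refl
proj₁-F L [] (_ ∷ _) = refl
proj₁-F L (x ∷ xs) u = proj₁-W L x (proj₁-F (ℤ.suc L) xs) nothing u

proj₁-eval : ∀ (f : Word → ℚ × ℚ) a → proj₁ (D.eval f a) ≡ Q.eval (proj₁ ∘ f) a
proj₁-eval f [] = refl
proj₁-eval f ((c , u) ∷ a) = cong (c ℚ.* proj₁ (f u) ℚ.+_) (proj₁-eval f a)

eval-null : ∀ {f} a → D.RowInvariant f → a ≡m [] → D.eval f a ≡ (0ℚ , 0ℚ)
eval-null {f} a inv a≡0 = trans (D.eval-ext (λ u → inv (row u)) a)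
  (trans (sym (D.eval-mapKey mrow (f ∘ emb) a))
    (D.eval-≡0 _≟R_ (f ∘ emb) (mapKey mrow a) (λ v → trans (sym (mcoeff-kcoeff a v)) (a≡0 v))))

row-rowOK : ∀ {h p r} → Row p r → All (λ z → val z ℤ.< h) p → RowOK h r
row-rowOK nil [] = [] , []
row-rowOK one (t<h ∷ []) = [-] , t<h ∷ []
row-rowOK (weak _ r) (_ ∷ b) with row-rowOK r b
... | asc , m<h ∷ below = ℤP.≤-refl ∷ asc , m<h ∷ m<h ∷ below
row-rowOK (strict {t} {m = m} _ r) (t<h ∷ b) with row-rowOK r b
... | asc , below =
      ℤP.≤-trans (ℤP.i⊓j≤j (val t) (m ℤ.- ℤ.1ℤ)) (subst (m ℤ.- ℤ.1ℤ ℤ.≤_) (suc[i-1] m) (ℤP.i≤suc[i] _)) ∷ asc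
      , ℤP.≤-<-trans (ℤP.i⊓j≤i (val t) (m ℤ.- ℤ.1ℤ)) t<h ∷ below

mrow-rowOK : ∀ {N a} → Keys (IsBounded N) a → Keys (RowOK (ℤ.+ N)) (mapKey mrow a)
mrow-rowOK bs = AllP.map⁺ (All.map
  (λ {t} b → row-rowOK (row (proj₂ t)) (All.map (λ {z} → ∣z∣<N⇒z<N (val z)) b)) bs)

mrow-∷ : ∀ z u → ∃ λ m → mrow (z ∷ u) ≡ m ∷ mrow u
mrow-∷ z [] = val z , refl
mrow-∷ z (t ∷ u) with mrow (t ∷ u) | row (t ∷ u)
... | m ∷ ms | _ = _ , refl

ξ-respects : ∀ a b → a ≡m b → ξ a ≡m ξ b
ξ-respects a b a≡b v = begin
  mcoeff (ξ a) v                          ≡⟨ as-eval a ⟩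
  Q.eval (tail-is ∘ mrow) a               ≡⟨ Q.eval-mapKey mrow tail-is a ⟨
  Q.eval tail-is (mapKey mrow a)          ≡⟨ Q.eval-resp _≟R_ tail-is (mapKey mrow a) (mapKey mrow b)
    (λ k → trans (sym (mcoeff-kcoeff a k)) (trans (a≡b k) (mcoeff-kcoeff b k))) ⟩
  Q.eval tail-is (mapKey mrow b)          ≡⟨ Q.eval-mapKey mrow tail-is b ⟩
  Q.eval (tail-is ∘ mrow) b               ≡⟨ as-eval b ⟨
  mcoeff (ξ b) v                          ∎
  where
  open ≡-Reasoning
  tail-is : List ℤ → ℚ
  -- `ξ` discards the empty word, so the empty row counts 0 even when `v` is empty.
  tail-is [] = 0ℚ
  tail-is (_ ∷ r) = if does (r ≟R v) then 1ℚ else 0ℚ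
  as-eval : ∀ a → mcoeff (ξ a) v ≡ Q.eval (tail-is ∘ mrow) a
  as-eval [] = refl
  as-eval ((c , []) ∷ a) = trans (as-eval a)
    (sym (trans (cong (ℚ._+ Q.eval (tail-is ∘ mrow) a) (ℚP.*-zeroʳ c)) (ℚP.+-identityˡ _)))
  as-eval ((c , z ∷ u) ∷ a) = cong₂ ℚ._+_
    (trans (term (does (mrow u ≟R v))) (cong (λ r → c ℚ.* tail-is r) (sym (proj₂ (mrow-∷ z u))))) (as-eval a)
    where
    term : ∀ d → (if d then c else 0ℚ) ≡ c ℚ.* (if d then 1ℚ else 0ℚ)
    term true  = sym (ℚP.*-identityʳ c)
    term false = sym (ℚP.*-zeroʳ c)

∇-bounded : ∀ {N a} → Keys (IsBounded N) a → Keys (IsBounded N) (∇ a)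
∇-bounded {a = []} [] = []
∇-bounded {a = (c , []) ∷ a} (_ ∷ bs) = ∇-bounded bs
∇-bounded {a = (c , z ∷ u) ∷ a} ((_ ∷ b) ∷ bs) = b ∷ ∇-bounded bs

∇-++ : ∀ a b → ∇ (a ++ b) ≡ ∇ a ++ ∇ b
∇-++ [] b = refl
∇-++ ((c , []) ∷ a) b = ∇-++ a b
∇-++ ((c , z ∷ u) ∷ a) b = cong (_ ∷_) (∇-++ a b)

∇-scale : ∀ k a → ∇ (scale k a) ≡ scale k (∇ a)
∇-scale k [] = refl
∇-scale k ((c , []) ∷ a) = ∇-scale k a
∇-scale k ((c , z ∷ u) ∷ a) = cong₂ (λ q r → (q , u) ∷ r) (ℚP.*-assoc k c (val z ℚ./ 1)) (∇-scale k a)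

slide-∇-null : ∀ d → d ≡m [] → ∀ M (xs : Vec ℚ (M ℕ.+ M)) → let i = ℤ.- (ℤ.+ M) in
  D.eval (D.translated i (constants xs)) d ≡ D.eval (D.perturbed i (constants xs)) d →
  Q.eval (Q.F i xs) (∇ d) ≡ 0ℚ
slide-∇-null d d≡0 M xs agree = begin
  Q.eval (Q.F i xs) (∇ d)                       ≡⟨ Q.eval-ext (proj₁-F i xs) (∇ d) ⟨
  Q.eval (proj₁ ∘ f) (∇ d)                      ≡⟨ proj₁-eval f (∇ d) ⟨
  proj₁ (D.eval f (∇ d))                        ≡⟨ Dual.proj₂-ε⊗ (D.eval f (∇ d)) ⟨
  proj₂ (Dual.ε Dual.⊗ D.eval f (∇ d))          ≡⟨ cong proj₂ ε∇≡0 ⟩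
  0ℚ                                            ∎
  where
  open ≡-Reasoning
  open Scalars Dual.scalars
  i = ℤ.- (ℤ.+ M)
  f = D.F i (constants xs)
  κ = ι (1ℚ ℚ.- (i ℚ./ 1))
  ε∇≡0 : Dual.ε * D.eval f (∇ d) ≡ 0#
  ε∇≡0 = begin
    Dual.ε * D.eval f (∇ d)
      ≡⟨ cong (Dual.ε *_) (trans (sym (+-identityʳ (D.eval f (∇ d)))) (cong (D.eval f (∇ d) +_) (sym (zeroʳ κ)))) ⟩
    Dual.ε * (D.eval f (∇ d) + κ * 0#)
      ≡⟨ cong (λ s → Dual.ε * (D.eval f (∇ d) + κ * s)) (eval-null (ξ d) (D.F-row i (constants xs)) (ξ-respects d [] d≡0)) ⟨
    Dual.ε * (D.eval f (∇ d) + κ * D.eval f (ξ d))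
      ≡⟨ +-identityˡ _ ⟨
    0# + Dual.ε * (D.eval f (∇ d) + κ * D.eval f (ξ d))
      ≡⟨ cong (_+ Dual.ε * (D.eval f (∇ d) + κ * D.eval f (ξ d))) (eval-null d (D.F-row i (constants xs)) d≡0) ⟨
    D.eval f d + Dual.ε * (D.eval f (∇ d) + κ * D.eval f (ξ d))
      ≡⟨ D.eval-perturbed i (constants xs) d ⟨
    D.eval (D.perturbed i (constants xs)) d
      ≡⟨ agree ⟨
    D.eval (D.translated i (constants xs)) d
      ≡⟨ eval-null d (D.F-row i (Vec.map (_+ Dual.ε) (constants xs))) d≡0 ⟩
    0# ∎

∇-null : ∀ {d} → Inℛ d → d ≡m [] → ∇ d ≡m []
∇-null {d} rd d≡0 v with Linked.linked? ℤP._≤?_ v | bound-𝒬 d | bound-word (emb v) | D.ℛ-agree rd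
... | no ¬asc | N , b | _ | _ = trans (mcoeff-kcoeff (∇ d) v)
      (kcoeff-absent _≟R_ (mapKey mrow (∇ d))
        (All.map (λ { (asc , _) refl → ¬asc asc }) (mrow-rowOK (∇-bounded b))))
... | yes asc | N₁ , b₁ | N₂ , b₂ | N₃ , agree = trans (mcoeff-kcoeff (∇ d) v)
      (Independence.slides-independent (M ℕ.+ M) i (mapKey mrow (∇ d)) (-N+[N+N] M) rows null v (low v asc b₂))
  where
  -- `N₁` bounds the letters of `d`, so that the rows of `∇ d` stay below `M`; `N₂` makes the window
  -- start low enough to detect `v`; from `N₃` on the two characters agree on `d`.
  M = N₁ ℕ.⊔ (N₂ ℕ.⊔ N₃)
  N₁≤M = ℕP.m≤m⊔n N₁ (N₂ ℕ.⊔ N₃)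
  N₂≤M = ℕP.≤-trans (ℕP.m≤m⊔n N₂ N₃) (ℕP.m≤n⊔m N₁ (N₂ ℕ.⊔ N₃))
  N₃≤M = ℕP.≤-trans (ℕP.m≤n⊔m N₂ N₃) (ℕP.m≤n⊔m N₁ (N₂ ℕ.⊔ N₃))
  i = ℤ.- (ℤ.+ M)
  rows : Keys (RowOK (ℤ.+ M)) (mapKey mrow (∇ d))
  rows = mrow-rowOK (All.map (bounded-mono N₁≤M) (∇-bounded b₁))
  null : ∀ xs → Q.eval (Q.F i xs ∘ emb) (mapKey mrow (∇ d)) ≡ 0ℚ
  null xs = trans (Q.eval-mapKey mrow (Q.F i xs ∘ emb) (∇ d))
    (trans (Q.eval-ext (λ u → sym (Q.F-row i xs (row u))) (∇ d))
      (slide-∇-null d d≡0 M xs (agree M N₃≤M (constants xs))))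
  low : ∀ v → Ascending v → IsBounded N₂ (emb v) → Ascending (i ∷ v)
  low [] _ _ = [-]
  low (t ∷ v) asc (l ∷ _) = ∣z∣<N⇒-N≤z t (ℕP.≤-trans l N₂≤M) ∷ asc

mcoeff-diff : ∀ a b v → mcoeff (a ++ scale (ℚ.- 1ℚ) b) v ≡ mcoeff a v ℚ.- mcoeff b v
mcoeff-diff a b v = begin
  mcoeff (a ++ scale (ℚ.- 1ℚ) b) v
    ≡⟨ mcoeff-kcoeff (a ++ scale (ℚ.- 1ℚ) b) v ⟩
  kcoeff _≟R_ (mapKey mrow (a ++ scale (ℚ.- 1ℚ) b)) v
    ≡⟨ cong (λ r → kcoeff _≟R_ r v) (trans (LP.map-++ _ a (scale (ℚ.- 1ℚ) b))
         (cong (mapKey mrow a ++_) (trans (sym (LP.map-∘ b)) (LP.map-∘ b)))) ⟩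
  kcoeff _≟R_ (mapKey mrow a ++ scaleLC (ℚ.- 1ℚ) (mapKey mrow b)) v
    ≡⟨ kcoeff-diff _≟R_ (mapKey mrow a) (mapKey mrow b) v ⟩
  kcoeff _≟R_ (mapKey mrow a) v ℚ.- kcoeff _≟R_ (mapKey mrow b) v
    ≡⟨ cong₂ ℚ._-_ (mcoeff-kcoeff a v) (mcoeff-kcoeff b v) ⟨
  mcoeff a v ℚ.- mcoeff b v ∎
  where open ≡-Reasoning

∇-respects : ∀ a b → Inℛ a → Inℛ b → a ≡m b → ∇ a ≡m ∇ b
∇-respects a b ra rb a≡b v = p-q≡0⇒p≡q (trans (sym (mcoeff-diff (∇ a) (∇ b) v))
  (trans (cong (λ c → mcoeff c v) (sym ∇-diff)) (∇-null (add ra (smul (ℚ.- 1ℚ) rb)) null v)))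
  where
  ∇-diff : ∇ (a ++ scale (ℚ.- 1ℚ) b) ≡ ∇ a ++ scale (ℚ.- 1ℚ) (∇ b)
  ∇-diff = trans (∇-++ a (scale (ℚ.- 1ℚ) b)) (cong (∇ a ++_) (∇-scale (ℚ.- 1ℚ) b))
  null : (a ++ scale (ℚ.- 1ℚ) b) ≡m []
  null v = trans (mcoeff-diff a b v)
    (trans (cong (ℚ._- mcoeff b v) (a≡b v)) (ℚP.+-inverseʳ (mcoeff b v)))
  p-q≡0⇒p≡q : ∀ {p q} → p ℚ.- q ≡ 0ℚ → p ≡ q
  p-q≡0⇒p≡q {p} {q} h = trans (solve 2 (λ p q → p := (p :- q) :+ q) refl p q)
    (trans (cong (ℚ._+ q) h) (ℚP.+-identityˡ q))
    where open +-*-Solver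

theorem4p23 : (∀ (a b : 𝒬) → a ≡m b → ξ a ≡m ξ b)
    × (∀ (a b : 𝒬) → Inℛ a → Inℛ b → a ≡m b → ∇ a ≡m ∇ b)
theorem4p23 = ξ-respects , ∇-respects
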